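{- Let $(W,S)$ be a Coxeter system and let $\omega$ be a finite word in the generators $S$. Then the $\omega$-sorting order extends the weak order on $W_\omega$ and is extended by the Bruhat order on $W_\omega$; that is, for all $u,w\in W_\omega$, $$u\leq_{\mathsf{R}}w\ \Longrightarrow\ u\leq_\omega w\quad\text{and}\quad u\leq_\omega w\ \Longrightarrow\ u\leq_{\mathsf{B}}w.$$
   Context: $(W,S)$ is an arbitrary Coxeter system with length function $\ell$. Let $\omega=(\omega_1,\dots,\omega_m)$. A subword $\alpha\subseteq\omega$ is identified with its index set $I(\alpha)=\{i_1<\dots<i_k\}\subseteq I(\omega)=\{1,\dots,m\}$, with $\alpha=(\omega_{i_1},\dots,\omega_{i_k})$. For a word $\alpha=(\alpha_1,\dots,\alpha_k)$ write $\langle\alpha\rangle=\alpha_1\cdots\alpha_k\in W$; $\alpha$ is reduced if $k=\ell(\langle\alpha\rangle)$. $W_\omega\subseteq W$ is the set of elements $\langle\alpha\rangle$ for subwords $\alpha\subseteq\omega$. For $A,B\subseteq I(\omega)$, $A\leq_{\mathsf{lex}}B$ means $A=B$ or $\min((A\cup B)\setminus(A\cap B))\in A$. For $u\in W_\omega$, the $\omega$-sorted word $\mathsf{sort}_\omega(u)$ is the subword of $\omega$ whose index set is $\leq_{\mathsf{lex}}$-minimum among index sets of subwords of $\omega$ that are reduced words for $u$. The $\omega$-sorting order on $W_\omega$ is: $u\leq_\omega w$ iff $I(\mathsf{sort}_\omega(u))\subseteq I(\mathsf{sort}_\omega(w))$. The (right) weak order on $W$: $u\leq_{\mathsf{R}}w$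 iff there is a reduced word $w=s_1\cdots s_\ell$ and $k\le \ell$ with $u=s_1\cdots s_k$. The Bruhat order on $W$: $u\leq_{\mathsf{B}}w$ iff there is a reduced word $w=s_1\cdots s_\ell$ and indices $i_1<\dots<i_k$ such that $u=s_{i_1}\cdots s_{i_k}$ is a reduced word for $u$. Both are restricted to $W_\omega$. -}

module Defs where

open import Algebra.Bundles using (Group)
open import Data.Bool using (true; false)
open import Data.Fin using (Fin) renaming (_≤_ to _≤ᶠ_)
open import Data.Fin.Subset using (Subset; _∈_; _⊆_; _∪_; _∩_; _─_)
open import Data.List using (List; []; _∷_; _++_; length; take; foldr; replicate; concat)
open import Data.Nat using (ℕ; _≤_)
open import Data.Product using (∃; ∃-syntax; _×_)
open import Data.Sum using (_⊎_)
open import Data.Vec using ([]; _∷_)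
open import Function.Bundles using (_⇔_)
open import Level using (Level; suc; _⊔_)
open import Relation.Binary.Core using (Rel)
open import Relation.Binary.Construct.Closure.Equivalence using (EqClosure)
open import Relation.Binary.PropositionalEquality using (_≡_)

private
  variable
    c ℓ a : Level

-- The value 0 stands for m(s,t) = ∞.  As the diagonal entries are 1 and all
-- others are different from 1, equality on the index set is decidable.
record CoxeterMatrix (S : Set a) : Set a where
  field
    m         : S → S → ℕ
    symmetric : ∀ s t → m s t ≡ m t s
    m≡1⇔≡     : ∀ s t → m s t ≡ 1 ⇔ s ≡ t

module _ {S : Set a} (M : CoxeterMatrix S) where
  open CoxeterMatrix M

  -- Deletion of a factor (s t)^m(s,t).  For m(s,t) = 0, i.e. ∞, the factor is
  -- empty and no relation is imposed.
  data Deletion : Rel (List S) a where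
    delete : ∀ α s t β →
             Deletion (α ++ concat (replicate (m s t) (s ∷ t ∷ [])) ++ β) (α ++ β)

  -- The congruence on the free monoid S* generated by the relations
  -- (s t)^m(s,t) = 1.  Since m(s,s) = 1 gives s s = 1, every generator is its
  -- own inverse modulo this congruence, so the quotient of S* is the group
  -- presented by the same generators and relations.
  CoxeterEquivalent : Rel (List S) a
  CoxeterEquivalent = EqClosure Deletion

record CoxeterSystem (c ℓ a : Level) : Set (suc (c ⊔ ℓ ⊔ a)) where
  field
    W      : Group c ℓ
    S      : Set a
    gen    : S → Group.Carrier W
    matrix : CoxeterMatrix S

  open Group W public using (Carrier; _≈_; _∙_; ε)

  ⟨_⟩ : List S → Carrier
  ⟨_⟩ = foldr (λ s w → gen s ∙ w) ε

  field
    generates : ∀ w → ∃[ α ] ⟨ α ⟩ ≈ w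
    presents  : ∀ α β → ⟨ α ⟩ ≈ ⟨ β ⟩ ⇔ CoxeterEquivalent matrix α β

subword : {S : Set a} (ω : List S) → Subset (length ω) → List S
subword []      []          = []
subword (s ∷ ω) (true  ∷ I) = s ∷ subword ω I
subword (s ∷ ω) (false ∷ I) = subword ω I

IsMinimum : ∀ {n} → Fin n → Subset n → Set
IsMinimum i A = i ∈ A × (∀ j → j ∈ A → i ≤ᶠ j)

infix 4 _≤lex_

_≤lex_ : ∀ {n} → Rel (Subset n) _
A ≤lex B = A ≡ B ⊎ ∃[ i ] (IsMinimum i ((A ∪ B) ─ (A ∩ B)) × i ∈ A)

module Orders (C : CoxeterSystem c ℓ a) where
  open CoxeterSystem C

  -- The length function is given by its graph: HasLength w k means ℓ(w) = k.
  HasLength : Carrier → ℕ → Set (ℓ ⊔ a)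
  HasLength w k = (∃[ α ] (⟨ α ⟩ ≈ w × length α ≡ k))
                × (∀ α → ⟨ α ⟩ ≈ w → k ≤ length α)

  Reduced : List S → Set (ℓ ⊔ a)
  Reduced α = HasLength ⟨ α ⟩ (length α)

  ReducedWordFor : Carrier → List S → Set (ℓ ⊔ a)
  ReducedWordFor w α = Reduced α × ⟨ α ⟩ ≈ w

  W[_] : List S → Carrier → Set ℓ
  W[ ω ] u = ∃[ I ] ⟨ subword ω I ⟩ ≈ u

  -- The graph of sort: IsSort ω u I means I = I(sort_ω(u)).
  IsSort : (ω : List S) → Carrier → Subset (length ω) → Set (ℓ ⊔ a)
  IsSort ω u I = ReducedWordFor u (subword ω I)
               × (∀ J → ReducedWordFor u (subword ω J) → I ≤lex J)

  infix 4 _≤[_]_ _≤R_ _≤B_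

  -- The index sets I and J are unique, as ≤lex is antisymmetric; their
  -- existence is part of the assertion u ≤[ ω ] w.
  _≤[_]_ : Carrier → List S → Carrier → Set (ℓ ⊔ a)
  u ≤[ ω ] w = ∃[ I ] ∃[ J ] (IsSort ω u I × IsSort ω w J × I ⊆ J)

  _≤R_ : Rel Carrier (ℓ ⊔ a)
  u ≤R w = ∃[ α ] ∃[ k ] (ReducedWordFor w α × k ≤ length α × u ≈ ⟨ take k α ⟩)

  _≤B_ : Rel Carrier (ℓ ⊔ a)
  u ≤B w = ∃[ α ] ∃[ I ] (ReducedWordFor w α × ReducedWordFor u (subword α I))

{-# OPTIONS --safe #-}

-- Scanning ω = s ω′ from the left, sort_ω(u) uses the letter s exactly when s is
-- a left descent of u, and continues on ω′ with s u, respectively u.  If u is a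
-- prefix of the reduced word w = u v and s is a descent of w but not of u, then by
-- the exchange condition s w = u v′ with one letter of v removed, so u ≤R s w, and
-- u ≤R w implies I(sort_ω(u)) ⊆ I(sort_ω(w)) by induction on ω.  The comparison
-- with the Bruhat order only uses that a subword of a subword is a subword.
--
-- Constructively, the existence of sort_ω(u) requires deciding left descents, and
-- the exchange condition has to be derived from the presentation without deciding
-- equality in W:
-- * The reflections t_i = s_1 ⋯ s_i ⋯ s_1 of a word, taken modulo cancellation of
--   equal pairs, depend only on the represented element, since the reflections of
--   (s t)^m(s,t) cancel in pairs.  This gives the deletion condition.
-- * A reduced word r α has the left descent s ≠ r if and only if α represents an
--   element with the alternating prefix s r s ⋯ of length m(r,s) − 1, which is a
--   question about shorter words.  "Only if" needs that r s has order exactly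
--   m(r,s), for which the reflection representation is used.
module Submission where

open import Defs
open import Algebra.Bundles using (Group)
import Algebra.Properties.Group
import Algebra.Solver.CommutativeMonoid as CommutativeMonoidSolver
open import Data.Bool using (true; false)
open import Data.Empty using (⊥-elim)
open import Data.Fin using (zero; suc) renaming (_≤_ to _≤ᶠ_)
open import Data.Fin.Subset using (Subset; _∪_; _∩_; _─_) renaming (_∈_ to _∈ˢ_; _⊆_ to _⊆ˢ_)
open import Data.Fin.Subset.Properties using (drop-there; drop-∷-⊆; s⊆s; out⊆)
open import Data.List using (List; []; _∷_; _++_; length; map; applyUpTo; concat; replicate; take; drop)
open import Data.List.Properties using (length-++; length-map; length-replicate; map-++; take++drop≡id)
import Data.List.Membership.Setoid
import Data.List.Membership.Setoid.Properties as Membership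
import Data.List.Relation.Binary.Equality.Setoid
import Data.List.Relation.Binary.Permutation.Setoid
import Data.List.Relation.Binary.Permutation.Setoid.Properties
open import Data.List.Relation.Binary.Sublist.Propositional using (_⊆_; _∷_; _∷ʳ_; ⊆-refl; ⊆-trans; [])
open import Data.List.Relation.Unary.Any using (here; there)
open import Data.Nat as ℕ using (ℕ; zero; suc; _≤_; _<_; z≤n; s≤s)
import Data.Nat.Divisibility as ℕ
open import Data.Nat.Induction using (<-wellFounded)
import Data.Nat.Properties as ℕ
open import Data.Product using (∃-syntax; _×_; _,_; proj₁; proj₂)
open import Data.Sum as Sum using (_⊎_; inj₁; inj₂; reduce)
open import Data.Vec using ([]; _∷_; here; there)
open import Function using (_∘_)
open import Function.Bundles using (Equivalence)
open import Induction.WellFounded using (Acc; acc)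
open import Level using (_⊔_)
open import Relation.Binary.Bundles using (Setoid)
import Relation.Binary.Construct.Closure.Equivalence as Eq
open import Relation.Binary.PropositionalEquality as ≡ using (_≡_; _≢_)
import Relation.Binary.Reasoning.Setoid
open import Relation.Nullary using (¬_; Dec; yes; no)

-- Words, index sets and the lexicographic order

power : ∀ {a} {S : Set a} → S → S → ℕ → List S
power s t k = concat (replicate k (s ∷ t ∷ []))

∷-≤lex : ∀ {n} {A B : Subset n} x → A ≤lex B → x ∷ A ≤lex x ∷ B
∷-≤lex x (inj₁ A≡B) = inj₁ (≡.cong (x ∷_) A≡B)
∷-≤lex {A = A} {B} x (inj₂ (i , (i∈ , least) , i∈A)) = inj₂ (suc i , (there i∈ , least′ x) , there i∈A)
  where
  least′ : ∀ x j → j ∈ˢ ((x ∷ A) ∪ (x ∷ B)) ─ ((x ∷ A) ∩ (x ∷ B)) → suc i ≤ᶠ j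
  -- An entry shared by both sets is never in the symmetric difference, so position `zero` is
  -- excluded for either value of `x`.
  least′ true  zero    ()
  least′ false zero    ()
  least′ x     (suc j) j∈ = s≤s (least j (drop-there j∈))

true≤lexfalse : ∀ {n} {A B : Subset n} → true ∷ A ≤lex false ∷ B
true≤lexfalse = inj₂ (zero , (here , λ _ _ → z≤n) , here)

subword-⊆ : ∀ {a} {S : Set a} (ω : List S) I → subword ω I ⊆ ω
subword-⊆ []      []          = []
subword-⊆ (s ∷ ω) (true  ∷ I) = ≡.refl ∷ subword-⊆ ω I
subword-⊆ (s ∷ ω) (false ∷ I) = s ∷ʳ subword-⊆ ω I

⊆⇒subword : ∀ {a} {S : Set a} {α ω : List S} → α ⊆ ω → ∃[ I ] subword ω I ≡ α
⊆⇒subword []             = [] , ≡.refl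
⊆⇒subword (s ∷ʳ p)       = let I , eq = ⊆⇒subword p in false ∷ I , eq
⊆⇒subword (≡.refl ∷ p)   = let I , eq = ⊆⇒subword p in true ∷ I , ≡.cong (_ ∷_) eq

-- `K` is `I` with the positions outside `J` deleted.
restrict : ∀ {a} {S : Set a} (ω : List S) I J → I ⊆ˢ J → ∃[ K ] subword (subword ω J) K ≡ subword ω I
restrict []      []          []          _   = [] , ≡.refl
restrict (s ∷ ω) (true  ∷ I) (true  ∷ J) I⊆J = let K , eq = restrict ω I J (drop-∷-⊆ I⊆J) in true ∷ K , ≡.cong (s ∷_) eq
restrict (s ∷ ω) (false ∷ I) (true  ∷ J) I⊆J = let K , eq = restrict ω I J (drop-∷-⊆ I⊆J) in false ∷ K , eq
restrict (s ∷ ω) (false ∷ I) (false ∷ J) I⊆J = restrict ω I J (drop-∷-⊆ I⊆J)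
restrict (s ∷ ω) (true  ∷ I) (false ∷ J) I⊆J with () ← I⊆J here

module Representation where
  open import Data.Integer using (ℤ; +_; -_; _+_; _*_; 0ℤ; 1ℤ; -1ℤ)
  import Data.Integer as ℤ using (∣_∣)
  open import Data.Integer.Divisibility.Signed using (_∣?_; ∣⇒∣ᵤ; ∣m∣n⇒∣m+n; ∣m+n∣n⇒∣m; ∣-refl; _∣_)
  import Data.Integer.Properties as ℤ
  open import Data.Integer.Properties
    using (+-identityʳ; +-comm; +-inverseˡ; *-identityʳ; *-zeroʳ; *-zeroˡ; *-identityˡ; *-distribˡ-+; *-distribʳ-+)
  open import Data.Integer.Tactic.RingSolver using (solve-∀)
  open ≡

  -- Finite sums and sequences with a Chebyshev recurrence

  ∑ : ℕ → (ℕ → ℤ) → ℤ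
  ∑ zero    f = 0ℤ
  ∑ (suc n) f = ∑ n f + f n

  ∑-cong : ∀ {f g} n → (∀ i → f i ≡ g i) → ∑ n f ≡ ∑ n g
  ∑-cong zero    h = refl
  ∑-cong (suc n) h = cong₂ _+_ (∑-cong n h) (h n)

  ∑-+ : ∀ f g n → ∑ n (λ i → f i + g i) ≡ ∑ n f + ∑ n g
  ∑-+ f g zero    = refl
  ∑-+ f g (suc n) rewrite ∑-+ f g n = interchange (∑ n f) (∑ n g) (f n) (g n)
    where
    interchange : ∀ a b c d → a + b + (c + d) ≡ a + c + (b + d)
    interchange = solve-∀

  ∑-neg : ∀ f n → ∑ n (λ i → - f i) ≡ - ∑ n f
  ∑-neg f zero    = refl
  ∑-neg f (suc n) rewrite ∑-neg f n = sym (ℤ.neg-distrib-+ (∑ n f) (f n))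

  ∑-*ˡ : ∀ a f n → ∑ n (λ i → a * f i) ≡ a * ∑ n f
  ∑-*ˡ a f zero    = sym (*-zeroʳ a)
  ∑-*ˡ a f (suc n) rewrite ∑-*ˡ a f n = sym (*-distribˡ-+ a (∑ n f) (f n))

  ∑-*ʳ : ∀ a f n → ∑ n (λ i → f i * a) ≡ ∑ n f * a
  ∑-*ʳ a f zero    = sym (*-zeroˡ a)
  ∑-*ʳ a f (suc n) rewrite ∑-*ʳ a f n = sym (*-distribʳ-+ a (∑ n f) (f n))

  ∑-head : ∀ f n → ∑ (suc n) f ≡ f 0 + ∑ n (f ∘ suc)
  ∑-head f zero    = +-comm 0ℤ (f 0)
  ∑-head f (suc n) rewrite ∑-head f n = ℤ.+-assoc (f 0) (∑ n (f ∘ suc)) (f (suc n))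

  twice : ℕ → ℤ
  twice i = + (i ℕ.+ i)

  twice-suc : ∀ i → twice (suc i) ≡ twice i + + 2
  twice-suc i = cong +_ (trans (cong suc (ℕ.+-suc i i)) (ℕ.+-comm 2 (i ℕ.+ i)))

  -- The recurrence v (2 + n) = (ζ + ζ⁻¹) v (1 + n) − v n, ζ being the shift by 1.
  Wave : (ℕ → ℤ → ℤ) → Set
  Wave v = ∀ n x → v (2 ℕ.+ n) x ≡ v (1 ℕ.+ n) (x + 1ℤ) + v (1 ℕ.+ n) (x + -1ℤ) + - v n x

  module _ (v : ℕ → ℤ → ℤ) (wave : Wave v) where

    -- U_a v_{b+1} − U_{a−1} v_b = v_{a+b+1} for the Chebyshev polynomial
    -- U_a = ζ^a + ζ^{a−2} + ⋯ + ζ^{−a}, evaluated at y + a and with the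
    -- subtracted term moved to the other side.
    spread : ∀ a b y →
      ∑ (suc a) (λ i → v (suc b) (y + twice i))
        ≡ ∑ a (λ i → v b (y + 1ℤ + twice i)) + v (suc (a ℕ.+ b)) (y + + a)
    spread zero    b y = refl
    spread (suc a) b y = begin
      A + v (suc b) (y + twice (suc a))                 ≡⟨ cong (λ x → A + v (suc b) x) (reshape (twice-suc a)) ⟩
      A + B                                             ≡⟨ shuffle A B C D ⟩
      (D + B) + A + - C + C + - D                       ≡⟨ cong (λ x → x + C + - D) expand ⟨
      ∑ (suc a) (λ i → v (2 ℕ.+ b) (y + 1ℤ + twice i)) + C + - D
                                                        ≡⟨ cong (λ x → x + C + - D) (spread a (suc b) (y + 1ℤ)) ⟩
      D + v (suc (a ℕ.+ suc b)) (y + 1ℤ + + a) + C + - D ≡⟨ cancel D _ C ⟩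
      C + v (suc (a ℕ.+ suc b)) (y + 1ℤ + + a)
        ≡⟨ cong₂ (λ n x → C + v (suc n) x) (ℕ.+-suc a b) (ℤ.+-assoc y 1ℤ (+ a)) ⟩
      C + v (suc (suc a ℕ.+ b)) (y + + suc a)           ∎
      where
      open ≡-Reasoning
      A = ∑ (suc a) (λ i → v (suc b) (y + twice i))
      B = v (suc b) (y + 1ℤ + 1ℤ + twice a)
      C = ∑ (suc a) (λ i → v b (y + 1ℤ + twice i))
      D = ∑ a (λ i → v (suc b) (y + 1ℤ + 1ℤ + twice i))
      reshape : ∀ {x z} → x ≡ z + + 2 → y + x ≡ y + 1ℤ + 1ℤ + z
      reshape {z = z} refl = lem y z
        where
        lem : ∀ y z → y + (z + + 2) ≡ y + 1ℤ + 1ℤ + z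
        lem = solve-∀
      shuffle : ∀ A B C D → A + B ≡ (D + B) + A + - C + C + - D
      shuffle = solve-∀
      cancel : ∀ D E C → D + E + C + - D ≡ C + E
      cancel = solve-∀
      swap : ∀ y z w → y + z + w ≡ y + w + z
      swap = solve-∀
      back : ∀ y z → y + 1ℤ + z + -1ℤ ≡ y + z
      back = solve-∀
      expand : ∑ (suc a) (λ i → v (2 ℕ.+ b) (y + 1ℤ + twice i)) ≡ (D + B) + A + - C
      expand = begin
        ∑ (suc a) (λ i → v (2 ℕ.+ b) (y + 1ℤ + twice i))
          ≡⟨ ∑-cong (suc a) (λ i → trans (wave b (y + 1ℤ + twice i))
               (cong₂ (λ p q → v (suc b) p + v (suc b) q + - v b (y + 1ℤ + twice i))
                 (swap (y + 1ℤ) (twice i) 1ℤ) (back y (twice i)))) ⟩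
        ∑ (suc a) (λ i → v (suc b) (y + 1ℤ + 1ℤ + twice i) + v (suc b) (y + twice i) + - v b (y + 1ℤ + twice i))
          ≡⟨ ∑-+ (λ i → v (suc b) (y + 1ℤ + 1ℤ + twice i) + v (suc b) (y + twice i)) _ (suc a) ⟩
        ∑ (suc a) (λ i → v (suc b) (y + 1ℤ + 1ℤ + twice i) + v (suc b) (y + twice i))
          + ∑ (suc a) (λ i → - v b (y + 1ℤ + twice i))
          ≡⟨ cong₂ _+_ (∑-+ (λ i → v (suc b) (y + 1ℤ + 1ℤ + twice i)) _ (suc a))
                       (∑-neg (λ i → v b (y + 1ℤ + twice i)) (suc a)) ⟩
        (D + B) + A + - C ∎

    -- v_1 + v_3 + ⋯ + v_{2n−1} = U_{n−1} v_n
    ∑-odd : ∀ n y → ∑ n (λ i → v (suc (i ℕ.+ i)) (y + + n)) ≡ ∑ n (λ i → v n (y + 1ℤ + twice i))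
    ∑-odd zero    y = refl
    ∑-odd (suc n) y = begin
      ∑ n (λ i → v (suc (i ℕ.+ i)) (y + + suc n)) + v (suc (n ℕ.+ n)) (y + + suc n)
        ≡⟨ cong (λ x → ∑ n (λ i → v (suc (i ℕ.+ i)) x) + v (suc (n ℕ.+ n)) x) (sym (ℤ.+-assoc y 1ℤ (+ n))) ⟩
      ∑ n (λ i → v (suc (i ℕ.+ i)) (y + 1ℤ + + n)) + v (suc (n ℕ.+ n)) (y + 1ℤ + + n)
        ≡⟨ cong (_+ v (suc (n ℕ.+ n)) (y + 1ℤ + + n)) (∑-odd n (y + 1ℤ)) ⟩
      ∑ n (λ i → v n (y + 1ℤ + 1ℤ + twice i)) + v (suc (n ℕ.+ n)) (y + 1ℤ + + n)
        ≡⟨ spread n n (y + 1ℤ) ⟨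
      ∑ (suc n) (λ i → v (suc n) (y + 1ℤ + twice i)) ∎
      where open ≡-Reasoning

  -- Scalars with roots of unity

  -- Functions List ℤ → ℤ serve as scalars of the reflection representation.  The
  -- n-th coordinate is reserved for a root of unity ζ_n acting by a shift of that
  -- coordinate; it acts as the identity on lists that are too short.
  bump : ℕ → ℤ → List ℤ → List ℤ
  bump n       d []      = []
  bump zero    d (x ∷ e) = x + d ∷ e
  bump (suc n) d (x ∷ e) = x ∷ bump n d e

  bump-0 : ∀ n e → bump n 0ℤ e ≡ e
  bump-0 n       []      = refl
  bump-0 zero    (x ∷ e) = cong (_∷ e) (+-identityʳ x)
  bump-0 (suc n) (x ∷ e) = cong (x ∷_) (bump-0 n e)

  bump-bump : ∀ n d d′ e → bump n d (bump n d′ e) ≡ bump n (d′ + d) e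
  bump-bump n       d d′ []      = refl
  bump-bump zero    d d′ (x ∷ e) = cong (_∷ e) (ℤ.+-assoc x d′ d)
  bump-bump (suc n) d d′ (x ∷ e) = cong (x ∷_) (bump-bump n d d′ e)

  bump-comm : ∀ m n d d′ e → bump m d (bump n d′ e) ≡ bump n d′ (bump m d e)
  bump-comm m       n       d d′ []      = refl
  bump-comm zero    zero    d d′ (x ∷ e) = cong (_∷ e) (lem x d d′)
    where
    lem : ∀ x d d′ → x + d′ + d ≡ x + d + d′
    lem = solve-∀
  bump-comm zero    (suc n) d d′ (x ∷ e) = refl
  bump-comm (suc m) zero    d d′ (x ∷ e) = refl
  bump-comm (suc m) (suc n) d d′ (x ∷ e) = cong (x ∷_) (bump-comm m n d d′ e)

  length-bump : ∀ n d e → length (bump n d e) ≡ length e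
  length-bump n       d []      = refl
  length-bump zero    d (x ∷ e) = refl
  length-bump (suc n) d (x ∷ e) = cong suc (length-bump n d e)

  Coeff : Set
  Coeff = List ℤ → ℤ

  -- Multiplication by 2 cos(π/n) = ζ_n + ζ_n⁻¹, where ζ_1 = −1.  The shift ζ_0 has
  -- infinite order, so n = 0 stands for ∞ here as well.
  κ : ℕ → Coeff → Coeff
  κ 1 g e = - (g e + g e)
  κ n g e = g (bump n 1ℤ e) + g (bump n -1ℤ e)

  κ-shift : ∀ n → n ≢ 1 → ∀ g e → κ n g e ≡ g (bump n 1ℤ e) + g (bump n -1ℤ e)
  κ-shift zero          n≢1 g e = refl
  κ-shift (suc zero)    n≢1 g e = ⊥-elim (n≢1 refl)
  κ-shift (suc (suc n)) n≢1 g e = refl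

  κ-cong : ∀ n {g g′ : Coeff} e → (∀ e′ → length e′ ≡ length e → g e′ ≡ g′ e′) → κ n g e ≡ κ n g′ e
  κ-cong zero e h = cong₂ _+_ (h _ (length-bump 0 1ℤ e)) (h _ (length-bump 0 -1ℤ e))
  κ-cong (suc zero) e h = cong (λ x → - (x + x)) (h e refl)
  κ-cong (suc (suc n)) e h = cong₂ _+_ (h _ (length-bump _ 1ℤ e)) (h _ (length-bump _ -1ℤ e))

  κ-+ : ∀ n g g′ e → κ n (λ e → g e + g′ e) e ≡ κ n g e + κ n g′ e
  κ-+ n g g′ e with n ℕ.≟ 1
  ... | yes refl = lem (g e) (g′ e)
    where
    lem : ∀ a b → - (a + b + (a + b)) ≡ - (a + a) + - (b + b)
    lem = solve-∀
  ... | no n≢1 rewrite κ-shift n n≢1 (λ e → g e + g′ e) e | κ-shift n n≢1 g e | κ-shift n n≢1 g′ e =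
    lem (g (bump n 1ℤ e)) (g (bump n -1ℤ e)) (g′ (bump n 1ℤ e)) (g′ (bump n -1ℤ e))
    where
    lem : ∀ a b c d → a + c + (b + d) ≡ a + b + (c + d)
    lem = solve-∀

  κ-0 : ∀ n e → κ n (λ _ → 0ℤ) e ≡ 0ℤ
  κ-0 0 e = refl
  κ-0 1 e = refl
  κ-0 (suc (suc n)) e = refl

  -- 1 + ζ_n² + ⋯ + ζ_n^(2n−2) annihilates g.
  record Good (g : Coeff) : Set where
    constructor good
    field ∑≡0 : ∀ n e → 2 ≤ n → n < length e → ∑ n (λ i → g (bump n (twice i) e)) ≡ 0ℤ

  open Good

  Good-+ : ∀ {g g′} → Good g → Good g′ → Good (λ e → g e + g′ e)
  Good-+ {g} a b .∑≡0 n e p q =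
    trans (∑-+ (λ i → g (bump n (twice i) e)) _ n) (cong₂ _+_ (a .∑≡0 n e p q) (b .∑≡0 n e p q))

  Good-neg : ∀ {g} → Good g → Good (λ e → - g e)
  Good-neg {g} a .∑≡0 n e p q = trans (∑-neg (λ i → g (bump n (twice i) e)) n) (cong -_ (a .∑≡0 n e p q))

  Good-bump : ∀ {g} m d → Good g → Good (λ e → g (bump m d e))
  Good-bump {g} m d a .∑≡0 n e p q =
    trans (∑-cong n (λ i → cong g (bump-comm m n d (twice i) e)))
          (a .∑≡0 n (bump m d e) p (subst (n <_) (sym (length-bump m d e)) q))

  Good-κ : ∀ {g} n → Good g → Good (κ n g)
  Good-κ 0             a = Good-+ (Good-bump 0 1ℤ a) (Good-bump 0 -1ℤ a)
  Good-κ 1             a = Good-neg (Good-+ a a)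
  Good-κ (suc (suc n)) a = Good-+ (Good-bump _ 1ℤ a) (Good-bump _ -1ℤ a)

  module _ {n : ℕ} (n≢1 : n ≢ 1) (v : ℕ → Coeff) (rec : ∀ k e → v (2 ℕ.+ k) e ≡ κ n (v (suc k)) e + - v k e) where

    -- By `∑-odd` the sum is U_{n-1} v_n, that is, ζ^{1-n} (1 + ζ² + ⋯ + ζ^{2n-2}) v_n, and `Good`
    -- says that the bracket annihilates v_n.
    ∑-odd≡0 : (∀ k → Good (v k)) → ∀ e → n < length e → ∑ n (λ i → v (suc (i ℕ.+ i)) e) ≡ 0ℤ
    ∑-odd≡0 good-v e n<e with 2 ℕ.≤? n
    -- Only n = 0, standing for ∞, is left here, and its sum is empty.
    ... | no n<2 = vacuous n n≢1 n<2
      where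
      vacuous : ∀ n → n ≢ 1 → ¬ 2 ≤ n → ∑ n (λ i → v (suc (i ℕ.+ i)) e) ≡ 0ℤ
      vacuous zero          _ _ = refl
      vacuous (suc zero)    p _ = ⊥-elim (p refl)
      vacuous (suc (suc n)) _ q = ⊥-elim (q (s≤s (s≤s z≤n)))
    ... | yes 2≤n = begin
      ∑ n (λ i → v (suc (i ℕ.+ i)) e)
        -- The trivial shift is written as -n + n in order to apply `∑-odd` with y = -n.
        ≡⟨ ∑-cong n (λ i → cong (v (suc (i ℕ.+ i))) (trans (sym (bump-0 n e)) (cong (λ d → bump n d e) (sym (+-inverseˡ (+ n)))))) ⟩
      ∑ n (λ i → V (suc (i ℕ.+ i)) (- + n + + n))    ≡⟨ ∑-odd V wave n (- + n) ⟩
      ∑ n (λ i → V n (- + n + 1ℤ + twice i))         ≡⟨ ∑-cong n (λ i → cong (v n) (sym (bump-bump n _ _ e))) ⟩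
      ∑ n (λ i → v n (bump n (twice i) (bump n (- + n + 1ℤ) e)))
        ≡⟨ good-v n .∑≡0 n _ 2≤n (subst (n <_) (sym (length-bump n _ e)) n<e) ⟩
      0ℤ                                             ∎
      where
      open ≡-Reasoning
      V : ℕ → ℤ → ℤ
      V k x = v k (bump n x e)
      wave : Wave V
      wave k x = begin
        v (2 ℕ.+ k) (bump n x e)  ≡⟨ rec k _ ⟩
        κ n (v (suc k)) (bump n x e) + - V k x  ≡⟨ cong (_+ - V k x) (κ-shift n n≢1 (v (suc k)) _) ⟩
        v (suc k) (bump n 1ℤ (bump n x e)) + v (suc k) (bump n -1ℤ (bump n x e)) + - V k x
          ≡⟨ cong₂ (λ p q → v (suc k) p + v (suc k) q + - V k x) (bump-bump n 1ℤ x e) (bump-bump n -1ℤ x e) ⟩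
        V (suc k) (x + 1ℤ) + V (suc k) (x + -1ℤ) + - V k x ∎

  -- A scalar that separates the powers of every root of unity

  ψ : ℕ → ℤ → ℤ
  ψ n x with twice n ∣? x
  ... | yes _ = 1ℤ
  ... | no  _ = 0ℤ

  ψ-yes : ∀ n x → twice n ∣ x → ψ n x ≡ 1ℤ
  ψ-yes n x d with twice n ∣? x
  ... | yes _ = refl
  ... | no ¬d = ⊥-elim (¬d d)

  ψ-no : ∀ n x → ¬ twice n ∣ x → ψ n x ≡ 0ℤ
  ψ-no n x ¬d with twice n ∣? x
  ... | yes d = ⊥-elim (¬d d)
  ... | no _ = refl

  ψ-periodic : ∀ n x → ψ n (x + twice n) ≡ ψ n x
  ψ-periodic n x with twice n ∣? x
  ... | yes d = ψ-yes n _ (∣m∣n⇒∣m+n d ∣-refl)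
  ... | no ¬d = ψ-no n _ (λ d → ¬d (∣m+n∣n⇒∣m d ∣-refl))

  -- For n ≥ 2, the sum of φ n over x, x + 2, …, x + 2n − 2 telescopes to zero,
  -- while φ n 0 = 1 is not repeated at 2, 4, …, 2n − 2.
  φ : ℕ → ℤ → ℤ
  φ 0 x = x + 1ℤ
  φ 1 x = 1ℤ
  φ n x = ψ n x + - ψ n (x + - + 2)

  telescope : ∀ (f : ℤ → ℤ) n x → ∑ n (λ i → f (x + twice i) + - f (x + twice i + - + 2)) ≡ f (x + - + 2 + twice n) + - f (x + - + 2)
  telescope f zero    x = lem (x + - + 2)
    where
    lem : ∀ x → 0ℤ ≡ f (x + 0ℤ) + - f x
    lem x rewrite +-identityʳ x = sym (ℤ.+-inverseʳ (f x))
  telescope f (suc n) x rewrite telescope f n x | twice-suc n =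
    trans (cong₂ (λ p q → f p + - f (x + - + 2) + (f q + - f (x + twice n + - + 2))) (p₁ x (twice n)) refl)
      (trans (lem (f (x + twice n + - + 2)) (f (x + - + 2)) (f (x + twice n)))
        (cong (λ p → f p + - f (x + - + 2)) (p₂ x (twice n))))
    where
    p₁ : ∀ x y → x + - + 2 + y ≡ x + y + - + 2
    p₁ = solve-∀
    p₂ : ∀ x y → x + y ≡ x + - + 2 + (y + + 2)
    p₂ = solve-∀
    lem : ∀ a b c → a + - b + (c + - a) ≡ c + - b
    lem = solve-∀

  ∑-φ≡0 : ∀ n x → 2 ≤ n → ∑ n (λ i → φ n (x + twice i)) ≡ 0ℤ
  ∑-φ≡0 n@(suc (suc _)) x _ = trans (telescope (ψ n) n x)
    (trans (cong (_+ - ψ n (x + - + 2)) (ψ-periodic n (x + - + 2))) (ℤ.+-inverseʳ (ψ n (x + - + 2))))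
  ∑-φ≡0 1 x (s≤s ())

  small-∤ : ∀ n k → 0 < k → k < n → ¬ twice n ∣ twice k
  small-∤ n (suc k) _ k<n d = ℕ.>⇒∤ (ℕ.+-mono-< k<n k<n) (∣⇒∣ᵤ d)

  φ-0 : ∀ n → φ n 0ℤ ≡ 1ℤ
  φ-0 0 = refl
  φ-0 1 = refl
  φ-0 n@(suc (suc k)) = cong₂ (λ x y → x + - y) (ψ-yes n 0ℤ (∣m∣0 (twice n)))
    (ψ-no n (- + 2) (λ d → ℕ.>⇒∤ (s≤s (s≤s (ℕ.<-≤-trans (s≤s z≤n) (ℕ.m≤n+m (2 ℕ.+ k) k)))) (∣⇒∣ᵤ d)))
    where
    ∣m∣0 : ∀ m → m ∣ 0ℤ
    ∣m∣0 m = record { quotient = 0ℤ ; equality = refl }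

  φ-2k : ∀ n k → 0 < k → n ≡ 0 ⊎ k < n → φ n (twice k) ≢ 1ℤ
  φ-2k 0 (suc k) _ _ eq = ℕ.m+1+n≢0 (k ℕ.+ suc k) (ℕ.suc-injective (cong ℤ.∣_∣ eq))
  φ-2k n@(suc (suc _)) k 0<k (inj₂ k<n) eq
    rewrite ψ-no n (twice k) (small-∤ n k 0<k k<n)
    -- The first term of `φ` is now 0, so its value is -1 or 0 in the two cases.
    with twice n ∣? (twice k + - + 2)
  φ-2k n@(suc (suc _)) k 0<k (inj₂ k<n) () | yes _
  φ-2k n@(suc (suc _)) k 0<k (inj₂ k<n) () | no _
  φ-2k 1 (suc k) _ (inj₂ (s≤s ()))

  -- The product of the functions `φ` over all coordinates, `n` being the index of the head of the
  -- list. One scalar thus handles all values of m(s,t) at once.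
  G : ℕ → Coeff
  G n []      = 1ℤ
  G n (x ∷ e) = φ n x * G (suc n) e

  -- Only the factor at the shifted coordinate, whose absolute index is `k`, depends on i. The
  -- others leave the sum, and `∑-φ≡0` applies.
  G-sum : ∀ {k} m n e → k ≡ m ℕ.+ n → m < length e → 2 ≤ k → ∑ k (λ i → G n (bump m (twice i) e)) ≡ 0ℤ
  G-sum zero n (x ∷ e) refl _ 2≤n = trans (∑-*ʳ (G (suc n) e) (λ i → φ n (x + twice i)) n)
    (trans (cong (_* G (suc n) e) (∑-φ≡0 n x 2≤n)) (*-zeroˡ (G (suc n) e)))
  G-sum {k} (suc m) n (x ∷ e) k≡ (s≤s m<e) 2≤k =
    trans (∑-*ˡ (φ n x) (λ i → G (suc n) (bump m (twice i) e)) k)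
      (trans (cong (φ n x *_) (G-sum m (suc n) e (trans k≡ (sym (ℕ.+-suc m n))) m<e 2≤k)) (*-zeroʳ (φ n x)))

  G-good : Good (G 0)
  G-good .∑≡0 n e 2≤n n<e = G-sum n 0 e (sym (ℕ.+-identityʳ n)) n<e 2≤n

  G-zeros : ∀ n k → G n (replicate k 0ℤ) ≡ 1ℤ
  G-zeros n zero    = refl
  G-zeros n (suc k) rewrite φ-0 n | G-zeros (suc n) k = refl

  G-bump-zeros : ∀ n m k x → G n (bump m x (replicate (suc (m ℕ.+ k)) 0ℤ)) ≡ φ (n ℕ.+ m) x
  G-bump-zeros n zero k x rewrite G-zeros (suc n) k | ℕ.+-identityʳ n =
    trans (*-identityʳ _) (cong (φ n) (ℤ.+-identityˡ x))
  G-bump-zeros n (suc m) k x rewrite φ-0 n | ℕ.+-suc n m = trans (*-identityˡ _) (G-bump-zeros (suc n) m k x)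

  -- The action of words on functionals

  module _ {a} {S : Set a} (M : CoxeterMatrix S) where
    open CoxeterMatrix M

    -- Functionals on the reflection representation, given by their values on the
    -- simple roots; words act from the right.
    State : Set a
    State = S → Coeff

    GoodState : State → Set a
    GoodState f = ∀ u → Good (f u)

    -- Precomposition with the reflection s, which adds 2 cos(π/m(s,u)) times the root of s to the
    -- root of u. For u = s the coefficient is -2.
    step : S → State → State
    step s f u e = f u e + κ (m s u) (f s) e

    act : List S → State → State
    act []      f = f
    act (s ∷ α) f = act α (step s f)

    act-++ : ∀ α β f → act (α ++ β) f ≡ act β (act α f)
    act-++ []      β f = refl
    act-++ (s ∷ α) β f = act-++ α β (step s f)

    step-good : ∀ s {f} → GoodState f → GoodState (step s f)
    step-good s f-good u = Good-+ (f-good u) (Good-κ (m s u) (f-good s))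

    act-good : ∀ α {f} → GoodState f → GoodState (act α f)
    act-good []      f-good = f-good
    act-good (s ∷ α) f-good = act-good α (step-good s f-good)

    m-diag : ∀ s → m s s ≡ 1
    m-diag s = Equivalence.from (m≡1⇔≡ s s) refl

    step-self : ∀ s f e → step s f s e ≡ - f s e
    step-self s f e rewrite m-diag s = lem (f s e)
      where
      lem : ∀ x → x + - (x + x) ≡ - x
      lem = solve-∀

    -- Applying s and t alternately to f, the coordinate reflected next takes the
    -- values v 1, v 2, v 3, …, while the other one is − v 0, − v 1, − v 2, ….
    record Orbit (s t : S) (f : State) (v : ℕ → Coeff) : Set where
      field
        rec : ∀ k e → v (2 ℕ.+ k) e ≡ κ (m s t) (v (suc k)) e + - v k e
        v₀  : ∀ e → v 0 e ≡ - f t e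
        v₁  : ∀ e → v 1 e ≡ f s e

    module _ {s t f v} (o : Orbit s t f v) where
      open Orbit o

      step-t : ∀ e → step s f t e ≡ v 2 e
      step-t e = begin
        f t e + κ (m s t) (f s) e     ≡⟨ cong (λ x → f t e + x) (κ-cong (m s t) e (λ e′ _ → sym (v₁ e′))) ⟩
        f t e + κ (m s t) (v 1) e     ≡⟨ lem (f t e) _ ⟩
        κ (m s t) (v 1) e + - - f t e ≡⟨ cong (λ x → κ (m s t) (v 1) e + - x) (v₀ e) ⟨
        κ (m s t) (v 1) e + - v 0 e   ≡⟨ rec 0 e ⟨
        v 2 e                         ∎
        where
        open ≡-Reasoning
        lem : ∀ a b → a + b ≡ b + - - a
        lem = solve-∀

      step-step : ∀ u e → step t (step s f) u e ≡ f u e + κ (m s u) (v 1) e + κ (m t u) (v 2) e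
      step-step u e = cong₂ (λ x y → f u e + x + y)
        (κ-cong (m s u) e (λ e′ _ → sym (v₁ e′))) (κ-cong (m t u) e (λ e′ _ → step-t e′))

      shift-orbit : Orbit s t (step t (step s f)) (λ k → v (2 ℕ.+ k))
      shift-orbit = record
        { rec = λ k → rec (2 ℕ.+ k)
        ; v₀  = λ e → trans (lem₀ (v 2 e)) (cong -_ (trans (cong -_ (sym (step-t e))) (sym (step-self t (step s f) e))))
        ; v₁  = λ e → begin
            v 3 e                            ≡⟨ rec 1 e ⟩
            κ (m s t) (v 2) e + - v 1 e      ≡⟨ cong₂ _+_ (trans (cong (λ n → κ n (v 2) e) (symmetric s t)) (κ-cong (m t s) e (λ e′ _ → sym (step-t e′))))
                                                          (trans (cong -_ (v₁ e)) (sym (step-self s f e))) ⟩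
            κ (m t s) (step s f t) e + step s f s e ≡⟨ +-comm _ (step s f s e) ⟩
            step t (step s f) s e            ∎
        }
        where
        open ≡-Reasoning
        lem₀ : ∀ a → a ≡ - - a
        lem₀ = solve-∀

    -- Each reflection adds `κ` of the value at the reflected root. These values are v 1, v 3, ...
    -- for s and v 2, v 4, ... for t, and `κ` is additive.
    act-power : ∀ {s t} k {f v} → Orbit s t f v → ∀ u e →
      act (power s t k) f u e ≡ f u e + κ (m s u) (λ e → ∑ k (λ i → v (suc (i ℕ.+ i)) e)) e
                                      + κ (m t u) (λ e → ∑ k (λ i → v (2 ℕ.+ (i ℕ.+ i)) e)) e
    act-power {s} {t} zero {f} o u e rewrite κ-0 (m s u) e | κ-0 (m t u) e = lem (f u e)
      where
      lem : ∀ x → x ≡ x + 0ℤ + 0ℤ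
      lem = solve-∀
    act-power {s} {t} (suc k) {f} {v} o u e = begin
      act (power s t k) (step t (step s f)) u e
        ≡⟨ act-power k (shift-orbit o) u e ⟩
      step t (step s f) u e + C (tail 1) + D (tail 2)
        ≡⟨ cong (λ x → x + C (tail 1) + D (tail 2)) (step-step o u e) ⟩
      f u e + C (v 1) + D (v 2) + C (tail 1) + D (tail 2)
        ≡⟨ lem (f u e) (C (v 1)) (D (v 2)) (C (tail 1)) (D (tail 2)) ⟩
      f u e + (C (v 1) + C (tail 1)) + (D (v 2) + D (tail 2))
        ≡⟨ cong₂ (λ x y → f u e + x + y) (join (m s u) 1) (join (m t u) 2) ⟩
      f u e + C (λ e → ∑ (suc k) (λ i → v (suc (i ℕ.+ i)) e)) + D (λ e → ∑ (suc k) (λ i → v (2 ℕ.+ (i ℕ.+ i)) e)) ∎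
      where
      open ≡-Reasoning
      tail : ℕ → Coeff
      tail j e = ∑ k (λ i → v (2 ℕ.+ (j ℕ.+ (i ℕ.+ i))) e)
      C D : Coeff → ℤ
      C g = κ (m s u) g e
      D g = κ (m t u) g e
      lem : ∀ a b c d e → a + b + c + d + e ≡ a + (b + d) + (c + e)
      lem = solve-∀
      index : ∀ j i → 2 ℕ.+ (j ℕ.+ (i ℕ.+ i)) ≡ j ℕ.+ suc (i ℕ.+ suc i)
      index j i = sym (trans (cong (λ x → j ℕ.+ suc x) (ℕ.+-suc i i))
                        (trans (ℕ.+-suc j _) (cong suc (ℕ.+-suc j _))))
      join : ∀ n j → κ n (v j) e + κ n (tail j) e ≡ κ n (λ e → ∑ (suc k) (λ i → v (j ℕ.+ (i ℕ.+ i)) e)) e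
      join n j = trans (sym (κ-+ n (v j) (tail j) e)) (κ-cong n e (λ e′ _ → sym
        (trans (∑-head (λ i → v (j ℕ.+ (i ℕ.+ i)) e′) k)
          (cong₂ _+_ (cong (λ x → v x e′) (ℕ.+-identityʳ j))
            (∑-cong k (λ i → cong (λ x → v x e′) (sym (index j i))))))))

    act-power-s : ∀ {s t} k {f v} → Orbit s t f v → ∀ e → act (power s t k) f s e ≡ v (suc (k ℕ.+ k)) e
    act-power-s zero    o e = sym (Orbit.v₁ o e)
    act-power-s (suc k) {v = v} o e = trans (act-power-s k (shift-orbit o) e)
      (cong (λ x → v (2 ℕ.+ x) e) (sym (ℕ.+-suc k k)))

    -- Short lists lack the coordinates that make a relation hold.
    infix 4 _≐_
    _≐_ : State → State → Set a
    f ≐ g = ∃[ N ] ∀ u e → N ≤ length e → f u e ≡ g u e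

    ≐-refl : ∀ {f} → f ≐ f
    ≐-refl = 0 , λ _ _ _ → refl

    ≐-sym : ∀ {f g} → f ≐ g → g ≐ f
    ≐-sym (N , h) = N , λ u e p → sym (h u e p)

    ≐-trans : ∀ {f g h} → f ≐ g → g ≐ h → f ≐ h
    ≐-trans (N , p) (N′ , q) = N ℕ.⊔ N′ , λ u e l →
      trans (p u e (ℕ.≤-trans (ℕ.m≤m⊔n N N′) l)) (q u e (ℕ.≤-trans (ℕ.m≤n⊔m N N′) l))

    act-cong : ∀ α {f g} → f ≐ g → act α f ≐ act α g
    act-cong []      eq      = eq
    act-cong (s ∷ α) (N , h) = act-cong α
      (N , λ u e l → cong₂ _+_ (h u e l) (κ-cong (m s u) e (λ e′ q → h s e′ (subst (N ≤_) (sym q) l))))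

    orbit : S → S → State → ℕ → Coeff
    orbit s t f zero          e = - f t e
    orbit s t f (suc zero)    e = f s e
    orbit s t f (suc (suc k)) e = κ (m s t) (orbit s t f (suc k)) e + - orbit s t f k e

    orbit-good : ∀ s t {f} → GoodState f → ∀ k → Good (orbit s t f k)
    orbit-good s t f-good zero          = Good-neg (f-good t)
    orbit-good s t f-good (suc zero)    = f-good s
    orbit-good s t f-good (suc (suc k)) =
      Good-+ (Good-κ (m s t) (orbit-good s t f-good (suc k))) (Good-neg (orbit-good s t f-good k))

    -- For m(s,t) = 1 the letters coincide and the two reflections undo each other. Otherwise both
    -- sums in `act-power` vanish by `∑-odd≡0`, the second one for the sequence shifted by one.
    relation : ∀ s t {f} → GoodState f → act (power s t (m s t)) f ≐ f
    relation s t {f} f-good with m s t ℕ.≟ 1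
    ... | yes p with refl ← Equivalence.to (m≡1⇔≡ s t) p rewrite m-diag s = 0 , λ u e _ → begin
      f u e + κ (m s u) (f s) e + κ (m s u) (step s f s) e
        ≡⟨ ℤ.+-assoc (f u e) _ _ ⟩
      f u e + (κ (m s u) (f s) e + κ (m s u) (step s f s) e)
        ≡⟨ cong (λ x → f u e + x) (trans (sym (κ-+ (m s u) (f s) (step s f s) e)) (trans (κ-cong (m s u) e (λ e′ _ →
             trans (cong (λ x → f s e′ + x) (step-self s f e′)) (ℤ.+-inverseʳ (f s e′)))) (κ-0 (m s u) e))) ⟩
      f u e + 0ℤ ≡⟨ +-identityʳ (f u e) ⟩
      f u e ∎
      where open ≡-Reasoning
    ... | no m≢1 = suc (m s t) , λ u e l → trans
          (act-power (m s t) {f} {v} (record { rec = λ _ _ → refl ; v₀ = λ _ → refl ; v₁ = λ _ → refl }) u e)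
          (trans (cong₂ (λ x y → f u e + x + y)
            (trans (κ-cong (m s u) e (λ e′ q → ∑-odd≡0 m≢1 v (λ _ _ → refl) (orbit-good s t f-good) e′ (subst (m s t <_) (sym q) l))) (κ-0 (m s u) e))
            (trans (κ-cong (m t u) e (λ e′ q → ∑-odd≡0 m≢1 (v ∘ suc) (λ _ _ → refl) (orbit-good s t f-good ∘ suc) e′ (subst (m s t <_) (sym q) l))) (κ-0 (m t u) e)))
            (lem (f u e)))
      where
      v = orbit s t f
      lem : ∀ x → x + 0ℤ + 0ℤ ≡ x
      lem = solve-∀

    SameAction : List S → List S → Set a
    SameAction α β = ∀ f → GoodState f → act α f ≐ act β f

    invariance : ∀ {α β} → CoxeterEquivalent M α β → SameAction α β
    invariance = Eq.fold {S = SameAction}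
      (record { refl  = λ _ _ → ≐-refl
              ; sym   = λ h f f-good → ≐-sym (h f f-good)
              ; trans = λ h h′ f f-good → ≐-trans (h f f-good) (h′ f f-good) })
      deletion
      where
      deletion : ∀ {α β} → Deletion M α β → SameAction α β
      deletion (delete α s t β) f f-good
        rewrite act-++ α (power s t (m s t) ++ β) f | act-++ α β f | act-++ (power s t (m s t)) β (act α f)
        = act-cong β (relation s t (act-good α f-good))

    -- A functional detecting the order of s t

    module _ (s t : S) (m≢1 : m s t ≢ 1) where
      n : ℕ
      n = m s t

      -- A matrix entry 1 identifies `u` with `s` or `t`. The values there are v 1 and -v 0 for the
      -- sequence `travelling`, as `Orbit` demands.
      start : State
      start u with m s u ℕ.≟ 1 | m t u ℕ.≟ 1
      ... | yes _ | _     = G 0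
      ... | no _  | yes _ = λ e → - G 0 (bump n -1ℤ e)
      ... | no _  | no _  = λ _ → 0ℤ

      start-good : GoodState start
      start-good u with m s u ℕ.≟ 1 | m t u ℕ.≟ 1
      ... | yes _ | _     = G-good
      ... | no _  | yes _ = Good-neg (Good-bump n -1ℤ G-good)
      ... | no _  | no _  = good λ n _ _ _ → ∑-zero n
        where
        ∑-zero : ∀ n → ∑ n (λ _ → 0ℤ) ≡ 0ℤ
        ∑-zero zero    = refl
        ∑-zero (suc n) rewrite ∑-zero n = refl

      start-s : start s ≡ G 0
      start-s with m s s ℕ.≟ 1 | m t s ℕ.≟ 1
      ... | yes _ | _ = refl
      ... | no ¬p | _ = ⊥-elim (¬p (m-diag s))

      start-t : start t ≡ (λ e → - G 0 (bump n -1ℤ e))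
      start-t with m s t ℕ.≟ 1 | m t t ℕ.≟ 1
      ... | yes p | _     = ⊥-elim (m≢1 p)
      ... | no _  | yes _ = refl
      ... | no _  | no ¬p = ⊥-elim (¬p (m-diag t))

      -- The eigensequence ζ^(k−1) G 0, on which (s t)^k acts as ζ^(2k).
      travelling : ℕ → Coeff
      travelling k e = G 0 (bump n (-1ℤ + + k) e)

      start-orbit : Orbit s t start travelling
      start-orbit = record
        { rec = λ k e → begin
            G 0 (bump n (-1ℤ + + (2 ℕ.+ k)) e)
              ≡⟨ lem₁ _ (G 0 (bump n (-1ℤ + + k) e)) ⟩
            G 0 (bump n (-1ℤ + + (2 ℕ.+ k)) e) + G 0 (bump n (-1ℤ + + k) e) + - G 0 (bump n (-1ℤ + + k) e)
              ≡⟨ cong (_+ - G 0 (bump n (-1ℤ + + k) e)) (cong₂ (λ x y → G 0 x + G 0 y)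
                   (trans (cong (λ x → bump n x e) (lem₂ (+ k))) (sym (bump-bump n _ 1ℤ e)))
                   (trans (cong (λ x → bump n x e) (lem₃ (+ k))) (sym (bump-bump n _ -1ℤ e)))) ⟩
            G 0 (bump n (-1ℤ + + suc k) (bump n 1ℤ e)) + G 0 (bump n (-1ℤ + + suc k) (bump n -1ℤ e)) + - G 0 (bump n (-1ℤ + + k) e)
              ≡⟨ cong (_+ - G 0 (bump n (-1ℤ + + k) e)) (κ-shift n m≢1 (travelling (suc k)) e) ⟨
            κ n (travelling (suc k)) e + - travelling k e ∎
        ; v₀  = λ e → trans (lem₀ _) (cong (λ f → - f e) (sym start-t))
        ; v₁  = λ e → trans (cong (G 0) (bump-0 n e)) (cong (λ f → f e) (sym start-s))
        }
        where
        open ≡-Reasoning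
        lem₀ : ∀ x → x ≡ - - x
        lem₀ = solve-∀
        lem₁ : ∀ x y → x ≡ x + y + - y
        lem₁ = solve-∀
        lem₂ : ∀ x → -1ℤ + (+ 2 + x) ≡ 1ℤ + (-1ℤ + (1ℤ + x))
        lem₂ = solve-∀
        lem₃ : ∀ x → -1ℤ + x ≡ -1ℤ + (-1ℤ + (1ℤ + x))
        lem₃ = solve-∀

      -- If (s t)^k were trivial, ζ^(2k) would fix `G 0` on long lists. Evaluation at a list of
      -- zeros would give φ_n(2k) = 1, against `φ-2k`.
      exact-order : ∀ k → 0 < k → n ≡ 0 ⊎ k < n → ¬ CoxeterEquivalent M (power s t k) []
      exact-order k 0<k bound eq with N , h ← invariance eq start start-good = φ-2k n k 0<k bound (begin
        φ n (twice k)                                 ≡⟨ G-bump-zeros 0 n N (twice k) ⟨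
        travelling (suc (k ℕ.+ k)) zeros              ≡⟨ act-power-s k start-orbit zeros ⟨
        act (power s t k) start s zeros               ≡⟨ h s zeros (subst (N ≤_) (sym (length-replicate (suc (n ℕ.+ N)))) (ℕ.m≤n⇒m≤1+n (ℕ.m≤n+m N n))) ⟩
        start s zeros                                 ≡⟨ cong (λ f → f zeros) start-s ⟩
        G 0 zeros                                     ≡⟨ G-zeros 0 (suc (n ℕ.+ N)) ⟩
        1ℤ                                            ∎)
        where
        open ≡-Reasoning
        zeros : List ℤ
        -- Long enough to contain coordinate `n` and to reach the threshold `N` of `_≐_`.
        zeros = replicate (suc (n ℕ.+ N)) 0ℤ

-- Lists modulo cancellation of equal pairs

module Pairing {c ℓ} (T : Setoid c ℓ) where
  open Setoid T using (_≈_; refl; sym; trans) renaming (Carrier to A)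
  open Data.List.Membership.Setoid T public using (_∈_)
  open Data.List.Relation.Binary.Permutation.Setoid T public using (_↭_; ↭-refl; ↭-sym; ↭-trans; ↭-prep; ↭-reflexive-≋)
  open Data.List.Relation.Binary.Permutation.Setoid.Properties T public
    using (∈-resp-↭; shift; drop-∷; ++⁺; ++⁺ˡ; ++⁺ʳ; ++-comm; xs↭ys⇒|xs|≡|ys|; ↭-shift; ++-commutativeMonoid)
  open CommutativeMonoidSolver ++-commutativeMonoid

  -- A pairing up to permutation replaces even multiplicities, which could only be counted by
  -- deciding `_≈_`.
  Even : List A → Set (c ⊔ ℓ)
  Even xs = ∃[ ys ] xs ↭ ys ++ ys

  even-resp-↭ : ∀ {xs ys} → xs ↭ ys → Even ys → Even xs
  even-resp-↭ p (zs , q) = zs , ↭-trans p q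

  extract : ∀ {x xs} → x ∈ xs → ∃[ ys ] xs ↭ x ∷ ys
  extract x∈xs with ys , zs , w , x≈w , eq ← Membership.∈-∃++ T x∈xs =
    ys ++ zs , ↭-trans (↭-reflexive-≋ eq) (shift (sym x≈w) ys zs)

  extract-pair : ∀ {x} ys → x ∈ ys ++ ys → ∃[ zs ] ys ++ ys ↭ x ∷ x ∷ zs ++ zs
  extract-pair {x} ys x∈ with zs , p ← extract (reduce (Membership.∈-++⁻ T ys x∈)) =
    zs , ↭-trans (++⁺ p p) (↭-prep x (↭-shift zs zs))

  even-cancel-pair : ∀ {x xs} → Even (x ∷ x ∷ xs) → Even xs
  even-cancel-pair (ys , p) with zs , q ← extract-pair ys (∈-resp-↭ p (here refl)) =
    zs , drop-∷ (drop-∷ (↭-trans p q))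

  even-cancel : ∀ xs {ys} → Even (xs ++ xs ++ ys) → Even ys
  even-cancel []       even = even
  even-cancel (x ∷ xs) {ys} even = even-cancel xs (even-cancel-pair
    (even-resp-↭ (↭-prep x (↭-sym (↭-shift xs (xs ++ ys)))) even))

  -- The two even lists together contain `ys` twice, and both copies cancel.
  even-trans : ∀ xs ys zs → Even (xs ++ ys) → Even (ys ++ zs) → Even (xs ++ zs)
  even-trans xs ys zs (us , p) (vs , q) = even-cancel ys (us ++ vs ,
    ↭-trans (solve 3 (λ x y z → (y ⊕ (y ⊕ (x ⊕ z))) ⊜ ((x ⊕ y) ⊕ (y ⊕ z))) ↭-refl xs ys zs)
      (↭-trans (++⁺ p q)
        (solve 2 (λ u v → ((u ⊕ u) ⊕ (v ⊕ v)) ⊜ ((u ⊕ v) ⊕ (u ⊕ v))) ↭-refl us vs)))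

  data Repeated : List A → Set (c ⊔ ℓ) where
    here  : ∀ {x xs} → x ∈ xs → Repeated (x ∷ xs)
    there : ∀ {x xs} → Repeated xs → Repeated (x ∷ xs)

  -- A pigeonhole argument: the partner of the head of `xs` lies in the rest of `xs`, a repetition,
  -- or in `ys`, and then the pair is removed and the inequality persists.
  even⇒repeated : ∀ xs ys → Even (xs ++ ys) → length ys < length xs → Repeated xs
  even⇒repeated (x ∷ xs) ys (zs , p) ys<xs
    with ws , q ← extract-pair zs (∈-resp-↭ p (here refl))
    with r ← drop-∷ (↭-trans p q)
    with Membership.∈-++⁻ T xs (∈-resp-↭ (↭-sym r) (here refl))
  ... | inj₁ x∈xs = here x∈xs
  ... | inj₂ x∈ys with ys′ , y ← extract x∈ys = there (even⇒repeated xs ys′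
        (ws , drop-∷ (↭-trans (↭-sym (↭-shift xs ys′)) (↭-trans (++⁺ˡ xs (↭-sym y)) r)))
        (ℕ.≤-pred (≡.subst (_< _) (xs↭ys⇒|xs|≡|ys| y) ys<xs)))

  repeated-map⁻ : ∀ {f : A → A} → (∀ {x y} → f x ≈ f y → x ≈ y) → ∀ xs → Repeated (map f xs) → Repeated xs
  repeated-map⁻ inj (x ∷ xs) (here x∈)  with y , y∈xs , eq ← Membership.∈-map⁻ T T x∈ =
    here (Membership.∈-resp-≈ T (inj (sym eq)) y∈xs)
  repeated-map⁻ inj (x ∷ xs) (there r) = there (repeated-map⁻ inj xs r)

module Coxeter {c ℓ a} (C : CoxeterSystem c ℓ a) where
  open CoxeterSystem C hiding (_≈_; _∙_; ε; Carrier)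
  open CoxeterMatrix matrix
  open Group W
  open Algebra.Properties.Group W using (inverseʳ-unique; ∙-cancelˡ)
  open Relation.Binary.Reasoning.Setoid setoid
  open Pairing setoid
  open Data.List.Relation.Binary.Equality.Setoid setoid using (_≋_; []; _∷_; ≋-refl; ≋-sym; ≋-trans; ≋-reflexive)
    renaming (++⁺ to ≋-++⁺)
  open CommutativeMonoidSolver ++-commutativeMonoid using (solve; _⊕_; _⊜_)

  -- Conjugation and the reflections of a word

  ⟨⟩-++ : ∀ α β → ⟨ α ++ β ⟩ ≈ ⟨ α ⟩ ∙ ⟨ β ⟩
  ⟨⟩-++ []      β = sym (identityˡ _)
  ⟨⟩-++ (s ∷ α) β = trans (∙-congˡ (⟨⟩-++ α β)) (sym (assoc _ _ _))

  power-m≈ε : ∀ s t → ⟨ power s t (m s t) ⟩ ≈ ε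
  power-m≈ε s t = trans (sym (trans (⟨⟩-++ (power s t (m s t)) []) (identityʳ _)))
    (Equivalence.from (presents _ _) (Eq.return (delete [] s t [])))

  gen∙gen≈ε : ∀ s → gen s ∙ gen s ≈ ε
  gen∙gen≈ε s with m s s | Equivalence.from (m≡1⇔≡ s s) ≡.refl | power-m≈ε s s
  ... | _ | ≡.refl | eq = trans (∙-congˡ (sym (identityʳ _))) eq

  gen-involutive : ∀ s x → gen s ∙ (gen s ∙ x) ≈ x
  gen-involutive s x = trans (sym (assoc _ _ _)) (trans (∙-congʳ (gen∙gen≈ε s)) (identityˡ x))

  gen-flip : ∀ {s x y} → gen s ∙ x ≈ y → x ≈ gen s ∙ y
  gen-flip {s} {x} eq = trans (sym (gen-involutive s x)) (∙-congˡ eq)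

  gen⁻¹≈gen : ∀ s → gen s ⁻¹ ≈ gen s
  gen⁻¹≈gen s = sym (inverseʳ-unique _ _ (gen∙gen≈ε s))

  conj : Carrier → Carrier → Carrier
  conj x y = x ∙ (y ∙ x ⁻¹)

  conj-cong : ∀ {x x′ y y′} → x ≈ x′ → y ≈ y′ → conj x y ≈ conj x′ y′
  conj-cong p q = ∙-cong p (∙-cong q (⁻¹-cong p))

  conj-∙ : ∀ x y → conj x y ∙ x ≈ x ∙ y
  conj-∙ x y = begin
    x ∙ (y ∙ x ⁻¹) ∙ x   ≈⟨ assoc _ _ _ ⟩
    x ∙ (y ∙ x ⁻¹ ∙ x)   ≈⟨ ∙-congˡ (assoc _ _ _) ⟩
    x ∙ (y ∙ (x ⁻¹ ∙ x)) ≈⟨ ∙-congˡ (∙-congˡ (inverseˡ x)) ⟩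
    x ∙ (y ∙ ε)          ≈⟨ ∙-congˡ (identityʳ y) ⟩
    x ∙ y                ∎

  conj-unique : ∀ {x y z} → z ∙ x ≈ x ∙ y → z ≈ conj x y
  conj-unique {x} {y} {z} eq = begin
    z               ≈⟨ identityʳ z ⟨
    z ∙ ε           ≈⟨ ∙-congˡ (inverseʳ x) ⟨
    z ∙ (x ∙ x ⁻¹)  ≈⟨ assoc _ _ _ ⟨
    z ∙ x ∙ x ⁻¹    ≈⟨ ∙-congʳ eq ⟩
    x ∙ y ∙ x ⁻¹    ≈⟨ assoc _ _ _ ⟩
    conj x y        ∎

  conj-ε : ∀ x → conj ε x ≈ x
  conj-ε x = sym (conj-unique (trans (identityʳ x) (sym (identityˡ x))))

  conj-conj : ∀ x y z → conj x (conj y z) ≈ conj (x ∙ y) z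
  conj-conj x y z = conj-unique (begin
    conj x (conj y z) ∙ (x ∙ y) ≈⟨ assoc _ _ _ ⟨
    conj x (conj y z) ∙ x ∙ y   ≈⟨ ∙-congʳ (conj-∙ x _) ⟩
    x ∙ conj y z ∙ y            ≈⟨ assoc _ _ _ ⟩
    x ∙ (conj y z ∙ y)          ≈⟨ ∙-congˡ (conj-∙ y z) ⟩
    x ∙ (y ∙ z)                 ≈⟨ assoc _ _ _ ⟨
    x ∙ y ∙ z                   ∎)

  conj-injective : ∀ x {y z} → conj x y ≈ conj x z → y ≈ z
  conj-injective x {y} {z} eq = ∙-cancelˡ x y z
    (trans (sym (conj-∙ x y)) (trans (∙-congʳ eq) (conj-∙ x z)))

  -- The list of the reflections t_i = s_1 ⋯ s_i ⋯ s_1.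
  Φ : List S → List Carrier
  Φ []      = []
  Φ (s ∷ α) = gen s ∷ map (conj (gen s)) (Φ α)

  length-Φ : ∀ α → length (Φ α) ≡ length α
  length-Φ []      = ≡.refl
  length-Φ (s ∷ α) = ≡.cong suc (≡.trans (length-map _ (Φ α)) (length-Φ α))

  map-≋ : ∀ {f g : Carrier → Carrier} → (∀ x → f x ≈ g x) → ∀ xs → map f xs ≋ map g xs
  map-≋ h []       = []
  map-≋ h (x ∷ xs) = h x ∷ map-≋ h xs

  map-cong-≋ : ∀ {f : Carrier → Carrier} → (∀ {x y} → x ≈ y → f x ≈ f y) → ∀ {xs ys} → xs ≋ ys → map f xs ≋ map f ys
  map-cong-≋ h []       = []
  map-cong-≋ h (p ∷ ps) = h p ∷ map-cong-≋ h ps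

  map-conj-map : ∀ x y zs → map (conj x) (map (conj y) zs) ≋ map (conj (x ∙ y)) zs
  map-conj-map x y []       = []
  map-conj-map x y (z ∷ zs) = conj-conj x y z ∷ map-conj-map x y zs

  map-conj-ε : ∀ xs → map (conj ε) xs ≋ xs
  map-conj-ε []       = []
  map-conj-ε (x ∷ xs) = conj-ε x ∷ map-conj-ε xs

  Φ-++ : ∀ α β → Φ (α ++ β) ≋ Φ α ++ map (conj ⟨ α ⟩) (Φ β)
  Φ-++ []      β = ≋-sym (map-conj-ε (Φ β))
  Φ-++ (s ∷ α) β = refl ∷ ≋-trans (map-cong-≋ (conj-cong refl) (Φ-++ α β))
    (≋-trans (≋-reflexive (map-++ (conj (gen s)) (Φ α) _))
      (≋-++⁺ ≋-refl (map-conj-map (gen s) ⟨ α ⟩ (Φ β))))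

  -- Alternating words and invariance of the reflections

  alt : ℕ → S → S → List S
  alt zero    s t = []
  alt (suc k) s t = s ∷ alt k t s

  length-alt : ∀ k s t → length (alt k s t) ≡ k
  length-alt zero    s t = ≡.refl
  length-alt (suc k) s t = ≡.cong suc (length-alt k t s)

  alt≡power : ∀ k s t → alt (k ℕ.+ k) s t ≡ power s t k
  alt≡power zero    s t = ≡.refl
  alt≡power (suc k) s t rewrite ℕ.+-suc k k = ≡.cong (λ α → s ∷ t ∷ α) (alt≡power k s t)

  power-rotate : ∀ k s t → ⟨ power s t (suc k) ⟩ ≈ gen s ∙ (⟨ power t s k ⟩ ∙ gen t)
  power-rotate zero    s t = ∙-congˡ (trans (identityʳ _) (sym (identityˡ _)))
  power-rotate (suc k) s t = begin
    gen s ∙ (gen t ∙ ⟨ power s t (suc k) ⟩)                ≈⟨ ∙-congˡ (∙-congˡ (power-rotate k s t)) ⟩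
    gen s ∙ (gen t ∙ (gen s ∙ (⟨ power t s k ⟩ ∙ gen t)))  ≈⟨ ∙-congˡ (∙-congˡ (assoc _ _ _)) ⟨
    gen s ∙ (gen t ∙ (gen s ∙ ⟨ power t s k ⟩ ∙ gen t))    ≈⟨ ∙-congˡ (assoc _ _ _) ⟨
    gen s ∙ (gen t ∙ (gen s ∙ ⟨ power t s k ⟩) ∙ gen t)    ∎

  power-+ : ∀ j k s t → ⟨ power s t (j ℕ.+ k) ⟩ ≈ ⟨ power s t j ⟩ ∙ ⟨ power s t k ⟩
  power-+ zero    k s t = sym (identityˡ _)
  power-+ (suc j) k s t = trans (∙-congˡ (∙-congˡ (power-+ j k s t)))
    (trans (∙-congˡ (sym (assoc _ _ _))) (sym (assoc _ _ _)))

  reflection : S → S → ℕ → Carrier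
  reflection s t i = ⟨ power s t i ⟩ ∙ gen s

  Φ-alt : ∀ k s t → Φ (alt k s t) ≋ applyUpTo (reflection s t) k
  Φ-alt zero    s t = []
  Φ-alt (suc k) s t = sym (identityˡ _) ∷
    ≋-trans (map-cong-≋ (conj-cong refl) (Φ-alt k t s)) (conjugate (reflection t s) (reflection s t ∘ suc) conj-reflection k)
    where
    conj-reflection : ∀ i → conj (gen s) (reflection t s i) ≈ reflection s t (suc i)
    conj-reflection i = begin
      gen s ∙ (reflection t s i ∙ gen s ⁻¹) ≈⟨ assoc _ _ _ ⟨
      gen s ∙ reflection t s i ∙ gen s ⁻¹   ≈⟨ ∙-cong (sym (power-rotate i s t)) (gen⁻¹≈gen s) ⟩
      reflection s t (suc i)                ∎
    conjugate : ∀ (f g : ℕ → Carrier) → (∀ i → conj (gen s) (f i) ≈ g i) → ∀ k →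
                map (conj (gen s)) (applyUpTo f k) ≋ applyUpTo g k
    conjugate f g h zero    = []
    conjugate f g h (suc k) = h 0 ∷ conjugate (f ∘ suc) (g ∘ suc) (h ∘ suc) k

  applyUpTo-+ : ∀ (f : ℕ → Carrier) j k → applyUpTo f (j ℕ.+ k) ≡ applyUpTo f j ++ applyUpTo (λ i → f (j ℕ.+ i)) k
  applyUpTo-+ f zero    k = ≡.refl
  applyUpTo-+ f (suc j) k = ≡.cong (f 0 ∷_) (applyUpTo-+ (f ∘ suc) j k)

  applyUpTo-≋ : ∀ {f g : ℕ → Carrier} → (∀ i → f i ≈ g i) → ∀ k → applyUpTo f k ≋ applyUpTo g k
  applyUpTo-≋ h zero    = []
  applyUpTo-≋ h (suc k) = h 0 ∷ applyUpTo-≋ (h ∘ suc) k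

  -- The reflections (s t)^i s are periodic in i with period m(s,t).
  even-Φ-power : ∀ s t → Even (Φ (power s t (m s t)))
  even-Φ-power s t = applyUpTo f n , ↭-reflexive-≋
    (≋-trans (≋-reflexive (≡.cong Φ (≡.sym (alt≡power n s t))))
      (≋-trans (Φ-alt (n ℕ.+ n) s t)
        (≋-trans (≋-reflexive (applyUpTo-+ f n n))
          (≋-++⁺ ≋-refl (applyUpTo-≋ periodic n)))))
    where
    n = m s t
    f = reflection s t
    periodic : ∀ i → f (n ℕ.+ i) ≈ f i
    periodic i = ∙-congʳ (trans (power-+ n i s t) (trans (∙-congʳ (power-m≈ε s t)) (identityˡ _)))

  even-map : ∀ {f : Carrier → Carrier} → (∀ {x y} → x ≈ y → f x ≈ f y) → ∀ {xs} → Even xs → Even (map f xs)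
  even-map {f} f-cong {xs} (ys , p) = map f ys ,
    ↭-trans (map⁺ p) (↭-reflexive (map-++ f ys ys))
    where
    open Data.List.Relation.Binary.Permutation.Setoid setoid using (↭-reflexive)
    map⁺ : ∀ {xs ys} → xs ↭ ys → map f xs ↭ map f ys
    map⁺ = Data.List.Relation.Binary.Permutation.Setoid.Properties.map⁺ setoid setoid f-cong

  -- The conclusion is an equivalence relation on words, so one deletion suffices. The deleted
  -- factor contributes an even list and, being trivial in W, does not change the conjugation of the
  -- later reflections.
  even-Φ : ∀ α β → ⟨ α ⟩ ≈ ⟨ β ⟩ → Even (Φ α ++ Φ β)
  even-Φ α β eq = Eq.fold {S = λ α β → Even (Φ α ++ Φ β)}
    (record { refl  = λ {α} → Φ α , ↭-refl
            ; sym   = λ {α} {β} → even-resp-↭ (++-comm (Φ β) (Φ α))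
            ; trans = λ {α} {β} {γ} → even-trans (Φ α) (Φ β) (Φ γ) })
    deletion (Equivalence.to (presents α β) eq)
    where
    deletion : ∀ {α β} → Deletion matrix α β → Even (Φ α ++ Φ β)
    deletion (delete α s t β) with ys , p ← even-map (conj-cong (refl {⟨ α ⟩})) (even-Φ-power s t) =
      Φ α ++ ys ++ B , ↭-trans
        (++⁺
          (↭-trans (↭-reflexive-≋ expand) (++⁺ˡ (Φ α) (++⁺ʳ B p)))
          (↭-reflexive-≋ (Φ-++ α β)))
        (solve 3 (λ a b y → ((a ⊕ ((y ⊕ y) ⊕ b)) ⊕ (a ⊕ b)) ⊜ ((a ⊕ (y ⊕ b)) ⊕ (a ⊕ (y ⊕ b)))) ↭-refl (Φ α) B ys)
      where
      ρ = power s t (m s t)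
      B = map (conj ⟨ α ⟩) (Φ β)
      expand : Φ (α ++ ρ ++ β) ≋ Φ α ++ map (conj ⟨ α ⟩) (Φ ρ) ++ B
      expand = ≋-trans (Φ-++ α (ρ ++ β)) (≋-++⁺ ≋-refl
        (≋-trans (map-cong-≋ (conj-cong refl) (≋-trans (Φ-++ ρ β)
            (≋-++⁺ ≋-refl (≋-trans (map-≋ (λ x → conj-cong (power-m≈ε s t) refl) (Φ β)) (map-conj-ε (Φ β))))))
          (≋-reflexive (map-++ (conj ⟨ α ⟩) (Φ ρ) (Φ β)))))

  -- Deletion and exchange

  remove : ∀ {x} α → x ∈ Φ α → ∃[ β ] (β ⊆ α × length α ≡ suc (length β) × x ∙ ⟨ α ⟩ ≈ ⟨ β ⟩)
  remove (s ∷ α) (here x≈s) = α , s ∷ʳ ⊆-refl , ≡.refl , trans (∙-congʳ x≈s) (gen-involutive s ⟨ α ⟩)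
  remove {x} (s ∷ α) (there x∈)
    with y , y∈ , x≈ ← Membership.∈-map⁻ setoid setoid x∈
    with β , β⊆α , len , eq ← remove α y∈ = s ∷ β , ≡.refl ∷ β⊆α , ≡.cong suc len , (begin
      x ∙ (gen s ∙ ⟨ α ⟩)                ≈⟨ ∙-congʳ x≈ ⟩
      conj (gen s) y ∙ (gen s ∙ ⟨ α ⟩)   ≈⟨ assoc _ _ _ ⟨
      conj (gen s) y ∙ gen s ∙ ⟨ α ⟩     ≈⟨ ∙-congʳ (conj-∙ (gen s) y) ⟩
      gen s ∙ y ∙ ⟨ α ⟩                  ≈⟨ assoc _ _ _ ⟩
      gen s ∙ (y ∙ ⟨ α ⟩)                ≈⟨ ∙-congˡ eq ⟩
      gen s ∙ ⟨ β ⟩                      ∎)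

  ∈-conj-self : ∀ s α → gen s ∈ map (conj (gen s)) (Φ α) → gen s ∈ Φ α
  ∈-conj-self s α p with y , y∈ , eq ← Membership.∈-map⁻ setoid setoid p =
    Membership.∈-resp-≈ setoid (sym (∙-cancelˡ (gen s) _ _ (trans (∙-congʳ eq) (conj-∙ (gen s) y)))) y∈

  -- Multiplication by t_i deletes the i-th letter. If t_i = t_j, the letters i and j can both be
  -- deleted, since t_i t_j = 1.
  remove-repeated : ∀ α → Repeated (Φ α) → ∃[ β ] (β ⊆ α × length β < length α × ⟨ α ⟩ ≈ ⟨ β ⟩)
  remove-repeated (s ∷ α) (here p) with β , β⊆α , len , eq ← remove α (∈-conj-self s α p) =
    β , s ∷ʳ β⊆α , ℕ.m≤n⇒m≤1+n (ℕ.≤-reflexive (≡.sym len)) , eq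
  remove-repeated (s ∷ α) (there r)
    with β , β⊆α , len , eq ← remove-repeated α (repeated-map⁻ (conj-injective (gen s)) (Φ α) r) =
    s ∷ β , ≡.refl ∷ β⊆α , s≤s len , ∙-congˡ eq

  -- Abstract, as its normal form is huge and gets unfolded by with-abstractions.
  abstract
    shorter⇒repeated : ∀ α β → ⟨ α ⟩ ≈ ⟨ β ⟩ → length β < length α → Repeated (Φ α)
    shorter⇒repeated α β eq β<α = even⇒repeated (Φ α) (Φ β) (even-Φ α β eq)
      (≡.subst₂ _<_ (≡.sym (length-Φ β)) (≡.sym (length-Φ α)) β<α)

  record Minimal (α : List S) : Set (ℓ ⊔ a) where
    constructor minimal
    field shortest : ∀ β → ⟨ β ⟩ ≈ ⟨ α ⟩ → length α ≤ length β

  open Minimal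

  minimal-resp : ∀ {α β} → ⟨ α ⟩ ≈ ⟨ β ⟩ → length α ≡ length β → Minimal α → Minimal β
  minimal-resp eq len μ .shortest γ eq′ = ≡.subst (_≤ _) len (μ .shortest γ (trans eq′ (sym eq)))

  minimal-tail : ∀ {s α} → Minimal (s ∷ α) → Minimal α
  minimal-tail {s} μ .shortest β eq = ℕ.≤-pred (μ .shortest (s ∷ β) (∙-congˡ eq))

  minimal-++ˡ : ∀ α β → Minimal (α ++ β) → Minimal α
  minimal-++ˡ α β μ .shortest γ eq = ℕ.+-cancelʳ-≤ (length β) _ _
    (≡.subst₂ _≤_ (length-++ α) (length-++ γ) (μ .shortest (γ ++ β)
      (trans (⟨⟩-++ γ β) (trans (∙-congʳ eq) (sym (⟨⟩-++ α β))))))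

  minimal⇒¬repeated : ∀ {α} → Minimal α → ¬ Repeated (Φ α)
  minimal⇒¬repeated {α} μ r with β , _ , β<α , eq ← remove-repeated α r = ℕ.<⇒≱ β<α (μ .shortest β (sym eq))

  -- The reflections of s α must repeat, but those of the minimal word α do not, so the repetition
  -- involves the first one, s itself.
  exchange : ∀ {s α} → Minimal α → ∀ β → ⟨ s ∷ α ⟩ ≈ ⟨ β ⟩ → length β ≤ length α → gen s ∈ Φ α
  exchange {s} {α} μ β eq β≤α with shorter⇒repeated (s ∷ α) β eq (s≤s β≤α)
  ... | here p  = ∈-conj-self s α p
  ... | there r = ⊥-elim (minimal⇒¬repeated μ (repeated-map⁻ (conj-injective (gen s)) (Φ α) r))

  remove-++ : ∀ {x} α β → x ∈ Φ (α ++ β) →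
    x ∈ Φ α ⊎ ∃[ γ ] (length β ≡ suc (length γ) × x ∙ ⟨ α ++ β ⟩ ≈ ⟨ α ++ γ ⟩)
  remove-++ {x} α β x∈ with Membership.∈-++⁻ setoid (Φ α) (Membership.∈-resp-≋ setoid (Φ-++ α β) x∈)
  ... | inj₁ p = inj₁ p
  ... | inj₂ p
    with y , y∈ , x≈ ← Membership.∈-map⁻ setoid setoid p
    with γ , _ , len , eq ← remove β y∈ = inj₂ (γ , len , (begin
      x ∙ ⟨ α ++ β ⟩                    ≈⟨ ∙-cong x≈ (⟨⟩-++ α β) ⟩
      conj ⟨ α ⟩ y ∙ (⟨ α ⟩ ∙ ⟨ β ⟩)    ≈⟨ assoc _ _ _ ⟨
      conj ⟨ α ⟩ y ∙ ⟨ α ⟩ ∙ ⟨ β ⟩      ≈⟨ ∙-congʳ (conj-∙ ⟨ α ⟩ y) ⟩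
      ⟨ α ⟩ ∙ y ∙ ⟨ β ⟩                 ≈⟨ assoc _ _ _ ⟩
      ⟨ α ⟩ ∙ (y ∙ ⟨ β ⟩)               ≈⟨ ∙-congˡ eq ⟩
      ⟨ α ⟩ ∙ ⟨ γ ⟩                     ≈⟨ ⟨⟩-++ α γ ⟨
      ⟨ α ++ γ ⟩                        ∎))

  -- Left descents and their decidability

  Descent : S → List S → Set (ℓ ⊔ a)
  Descent s α = ∃[ β ] (⟨ s ∷ β ⟩ ≈ ⟨ α ⟩ × suc (length β) ≡ length α)

  power≉ε : ∀ s t → m s t ≢ 1 → ∀ k → 0 < k → m s t ≡ 0 ⊎ k < m s t → ¬ ⟨ power s t k ⟩ ≈ ε
  power≉ε s t m≢1 k 0<k bound eq = Representation.exact-order matrix s t m≢1 k 0<k bound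
    (Equivalence.to (presents _ _) eq)

  AltPrefix : ℕ → S → S → List S → Set (ℓ ⊔ a)
  AltPrefix k s t α = ∃[ δ ] (⟨ alt k s t ++ δ ⟩ ≈ ⟨ α ⟩ × k ℕ.+ length δ ≡ length α)

  -- The prefix grows by exchange: the letter s can only cancel inside the prefix
  -- t s t ⋯ itself if a power (s t)^(i+1) with i < k is trivial.
  alt-prefix : ∀ k {s t α} → m s t ≢ 1 → m s t ≡ 0 ⊎ k ≤ m s t → Minimal α →
               Descent s α → Descent t α → AltPrefix k s t α
  alt-prefix zero {α = α} _ _ _ _ _ = α , refl , ≡.refl
  alt-prefix (suc k) {s} {t} {α} m≢1 bound μ ds@(σ , sσ≈α , len-σ) dt
    with δ , eq , len ← alt-prefix k {t} {s} {α} (m≢1 ∘ ≡.trans (symmetric s t))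
                          (≡.subst (λ n → n ≡ 0 ⊎ k ≤ n) (symmetric s t) (Sum.map₂ ℕ.<⇒≤ bound)) μ dt ds
    = go (remove-++ β δ (exchange (minimal-resp (sym eq) (≡.sym len-β) μ) σ
            (sym (gen-flip (trans sσ≈α (sym eq))))
            (ℕ.≤-trans (ℕ.n≤1+n _) (ℕ.≤-reflexive (≡.trans len-σ (≡.sym len-β))))))
    where
    β = alt k t s
    len-β : length (β ++ δ) ≡ length α
    len-β = ≡.trans (length-++ β) (≡.trans (≡.cong (ℕ._+ length δ) (length-alt k t s)) len)
    go : gen s ∈ Φ β ⊎ ∃[ γ ] (length δ ≡ suc (length γ) × gen s ∙ ⟨ β ++ δ ⟩ ≈ ⟨ β ++ γ ⟩) →
         AltPrefix (suc k) s t α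
    go (inj₁ s∈) with i , i<k , s≈ ← Membership.∈-applyUpTo⁻ setoid _ (Membership.∈-resp-≋ setoid (Φ-alt k t s) s∈) =
      ⊥-elim (power≉ε s t m≢1 (suc i) (s≤s z≤n) (Sum.map₂ (ℕ.≤-trans (s≤s i<k)) bound)
        (trans (power-rotate i s t) (trans (∙-congˡ (sym s≈)) (gen∙gen≈ε s))))
    go (inj₂ (γ , len-γ , eq-γ)) =
      γ , trans (sym (gen-flip eq-γ)) eq , ≡.trans (≡.sym (ℕ.+-suc k _)) (≡.trans (≡.cong (k ℕ.+_) (≡.sym len-γ)) len)

  -- For k = m(s,t) this becomes the braid relation, with no distinction by parity.
  alt-power : ∀ k s t → ⟨ alt k s t ⟩ ≈ ⟨ power s t k ⟩ ∙ ⟨ alt k t s ⟩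
  alt-power zero    s t = sym (identityˡ _)
  alt-power (suc k) s t = begin
    gen s ∙ ⟨ alt k t s ⟩                                       ≈⟨ ∙-congˡ (alt-power k t s) ⟩
    gen s ∙ (⟨ power t s k ⟩ ∙ ⟨ alt k s t ⟩)                   ≈⟨ ∙-congˡ (∙-congˡ (gen-involutive t _)) ⟨
    gen s ∙ (⟨ power t s k ⟩ ∙ (gen t ∙ (gen t ∙ ⟨ alt k s t ⟩))) ≈⟨ ∙-congˡ (assoc _ _ _) ⟨
    gen s ∙ (⟨ power t s k ⟩ ∙ gen t ∙ (gen t ∙ ⟨ alt k s t ⟩)) ≈⟨ assoc _ _ _ ⟨
    gen s ∙ (⟨ power t s k ⟩ ∙ gen t) ∙ (gen t ∙ ⟨ alt k s t ⟩) ≈⟨ ∙-congʳ (power-rotate k s t) ⟨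
    ⟨ power s t (suc k) ⟩ ∙ (gen t ∙ ⟨ alt k s t ⟩)             ∎

  braid : ∀ s t → ⟨ alt (m s t) s t ⟩ ≈ ⟨ alt (m s t) t s ⟩
  braid s t = trans (alt-power (m s t) s t) (trans (∙-congʳ (power-m≈ε s t)) (identityˡ _))

  altPrefix⇒descent : ∀ {k s r α} → m r s ≡ suc k → AltPrefix k s r α → Descent s (r ∷ α)
  altPrefix⇒descent {k} {s} {r} {α} m≡ (δ , eq , len) = alt k r s ++ δ , (begin
      ⟨ alt (suc k) s r ++ δ ⟩      ≈⟨ ⟨⟩-++ (alt (suc k) s r) δ ⟩
      ⟨ alt (suc k) s r ⟩ ∙ ⟨ δ ⟩   ≈⟨ ∙-congʳ (≡.subst (λ n → ⟨ alt n r s ⟩ ≈ ⟨ alt n s r ⟩) m≡ (braid r s)) ⟨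
      ⟨ alt (suc k) r s ⟩ ∙ ⟨ δ ⟩   ≈⟨ ⟨⟩-++ (alt (suc k) r s) δ ⟨
      ⟨ alt (suc k) r s ++ δ ⟩      ≈⟨ ∙-congˡ eq ⟩
      ⟨ r ∷ α ⟩                     ∎) ,
    ≡.cong suc (≡.trans (length-++ (alt k r s)) (≡.trans (≡.cong (ℕ._+ length δ) (length-alt k r s)) len))

  -- As r is a descent of r α as well, `alt-prefix` yields an alternating prefix starting with r,
  -- which is then cancelled.
  descent⇒altPrefix : ∀ {k s r α} → m r s ≢ 1 → m r s ≡ 0 ⊎ suc k ≤ m r s → Minimal (r ∷ α) →
                      Descent s (r ∷ α) → AltPrefix k s r α
  descent⇒altPrefix {k} {s} {r} {α} m≢1 bound μ d
    with δ , eq , len ← alt-prefix (suc k) m≢1 bound μ (α , refl , ≡.refl) d =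
    δ , ∙-cancelˡ (gen r) _ _ eq , ℕ.suc-injective len

  -- The bound n on the length only serves termination.
  descent? : ∀ n s α → length α ≤ n → Minimal α → Dec (Descent s α)
  altPrefix? : ∀ n k s r α → length α ≤ n → Minimal α → Dec (AltPrefix k s r α)

  descent? n s [] _ _ = no λ ()
  descent? (suc n) s (r ∷ α) (s≤s α≤n) μ with m r s in m≡
  -- For m(r,s) = ∞ a descent would give alternating prefixes of every length, in particular one
  -- longer than `α`.
  ... | zero = no λ d → ℕ.m+1+n≰m (length α)
        (ℕ.≤-trans (ℕ.≤-reflexive (ℕ.+-suc (length α) _)) (ℕ.≤-reflexive (proj₂ (proj₂ (descent⇒altPrefix {suc (length α)}
          (λ m≡1 → ℕ.0≢1+n (≡.trans (≡.sym m≡) m≡1)) (inj₁ m≡) μ d)))))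
  ... | suc zero with ≡.refl ← Equivalence.to (m≡1⇔≡ r s) m≡ = yes (α , refl , ≡.refl)
  ... | suc (suc k) with altPrefix? n (suc k) s r α α≤n (minimal-tail μ)
  ... | yes p = yes (altPrefix⇒descent {α = α} m≡ p)
  ... | no ¬p = no λ d → ¬p (descent⇒altPrefix (λ m≡1 → ℕ.0≢1+n (ℕ.suc-injective (≡.trans (≡.sym m≡1) m≡)))
                               (inj₂ (ℕ.≤-reflexive (≡.sym m≡))) μ d)

  altPrefix? n zero    s r α α≤n μ = yes (α , refl , ≡.refl)
  -- The first letter of the prefix is a descent. By cancellation the remaining element is
  -- determined, so testing one word `σ` for it decides the question.
  altPrefix? n (suc k) s r α α≤n μ with descent? n s α α≤n μ
  ... | no ¬d = no λ (δ , eq , len) → ¬d (alt k r s ++ δ , eq ,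
          ≡.trans (≡.cong suc (≡.trans (length-++ (alt k r s)) (≡.cong (ℕ._+ length δ) (length-alt k r s)))) len)
  ... | yes (σ , eq , len) with altPrefix? n k r s σ (ℕ.≤-trans (ℕ.n≤1+n _) (≡.subst (_≤ n) (≡.sym len) α≤n))
                                  (minimal-tail (minimal-resp (sym eq) (≡.sym len) μ))
  ... | yes (δ , eq′ , len′) = yes (δ , trans (∙-congˡ eq′) eq , ≡.trans (≡.cong suc len′) len)
  ... | no ¬p = no λ (δ , eq′ , len′) → ¬p (δ , ∙-cancelˡ (gen s) _ _ (trans eq′ (sym eq)) ,
          ℕ.suc-injective (≡.trans len′ (≡.sym len)))

  -- Sorted words and the comparison of the orders

  open Orders C

  minimal⇒reduced : ∀ α → Minimal α → Reduced α
  minimal⇒reduced α μ = (α , refl , ≡.refl) , μ .shortest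

  reduced⇒minimal : ∀ α → Reduced α → Minimal α
  reduced⇒minimal α (_ , shortest) = minimal shortest

  minimal-length : ∀ {α β} → Minimal α → Minimal β → ⟨ α ⟩ ≈ ⟨ β ⟩ → length α ≡ length β
  minimal-length {α} {β} μ ν eq = ℕ.≤-antisym (μ .shortest β (sym eq)) (ν .shortest α eq)

  shorten : ∀ {α} → Minimal α → ∀ ρ → Acc _<_ (length ρ) → ⟨ ρ ⟩ ≈ ⟨ α ⟩ →
            ∃[ β ] (β ⊆ ρ × ⟨ β ⟩ ≈ ⟨ α ⟩ × length β ≡ length α)
  shorten {α} μ ρ (acc rec) eq with length ρ ℕ.≟ length α
  ... | yes len = ρ , ⊆-refl , eq , len
  ... | no  len
    with β , β⊆ρ , β<ρ , ρ≈β ← remove-repeated ρ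
           (shorter⇒repeated ρ α eq (ℕ.≤∧≢⇒< (μ .shortest ρ eq) (len ∘ ≡.sym)))
    with γ , γ⊆β , γ≈α , len′ ← shorten μ β (rec β<ρ) (trans (sym ρ≈β) eq) =
    γ , ⊆-trans γ⊆β β⊆ρ , γ≈α , len′

  subword-minimal : ∀ {ω α} → Minimal α → W[ ω ] ⟨ α ⟩ →
                    ∃[ I ] (⟨ subword ω I ⟩ ≈ ⟨ α ⟩ × length (subword ω I) ≡ length α)
  subword-minimal {ω} μ (I , eq)
    with β , β⊆ , β≈α , len ← shorten μ (subword ω I) (<-wellFounded _) eq
    with J , ≡.refl ← ⊆⇒subword (⊆-trans β⊆ (subword-⊆ ω I)) = J , β≈α , len

  -- A reduced subword through the initial s loses that letter. One avoiding it lies in `ω` and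
  -- loses some letter by exchange, remaining a subword of `ω`.
  W-descent : ∀ {s ω α} → Minimal α → ((β , _) : Descent s α) → W[ s ∷ ω ] ⟨ α ⟩ → W[ ω ] ⟨ β ⟩
  W-descent {s} {ω} {α} μ (β , sβ≈α , len-β) w with subword-minimal μ w
  ... | true  ∷ I , eq , _ = I , ∙-cancelˡ (gen s) _ _ (trans eq (sym sβ≈α))
  ... | false ∷ I , eq , len
    with s-ρ ← sym (gen-flip (trans sβ≈α (sym eq)))
    with σ , σ⊆ρ , _ , sρ≈σ ← remove (subword ω I) (exchange (minimal-resp (sym eq) (≡.sym len) μ) β s-ρ
           (ℕ.≤-trans (ℕ.n≤1+n _) (ℕ.≤-reflexive (≡.trans len-β (≡.sym len)))))
    with J , ≡.refl ← ⊆⇒subword (⊆-trans σ⊆ρ (subword-⊆ ω I)) = J , trans (sym sρ≈σ) s-ρ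

  W-¬descent : ∀ {s ω α} → Minimal α → ¬ Descent s α → W[ s ∷ ω ] ⟨ α ⟩ → W[ ω ] ⟨ α ⟩
  W-¬descent {ω = ω} μ ¬d w with subword-minimal μ w
  ... | true  ∷ I , eq , len = ⊥-elim (¬d (subword ω I , eq , len))
  ... | false ∷ I , eq , _   = I , eq

  sort-[] : ∀ {u} → W[ [] ] u → IsSort [] u []
  sort-[] ([] , eq) = (minimal⇒reduced [] (minimal λ _ _ → z≤n) , eq) , λ { [] _ → inj₁ ≡.refl }

  -- An index set containing the first position precedes all those that avoid it. Among those
  -- containing it, the reduced subwords correspond to reduced subwords of `ω` for `β`.
  sort-descent : ∀ {s ω α I} → Minimal α → ((β , _) : Descent s α) →
                 IsSort ω ⟨ β ⟩ I → IsSort (s ∷ ω) ⟨ α ⟩ (true ∷ I)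
  sort-descent {s} {ω} {α} {I} μ (β , sβ≈α , len-β) ((red , eq) , min) =
    (minimal⇒reduced (s ∷ subword ω I) (minimal-resp (sym sρ≈α) len-ρ μ) , sρ≈α) , least
    where
    sρ≈α : ⟨ s ∷ subword ω I ⟩ ≈ ⟨ α ⟩
    sρ≈α = trans (∙-congˡ eq) sβ≈α
    len-ρ : length α ≡ length (s ∷ subword ω I)
    len-ρ = ≡.trans (≡.sym len-β) (≡.cong suc (minimal-length
      (minimal-tail (minimal-resp {β = s ∷ β} (sym sβ≈α) (≡.sym len-β) μ)) (reduced⇒minimal (subword ω I) red) (sym eq)))
    least : ∀ J → ReducedWordFor ⟨ α ⟩ (subword (s ∷ ω) J) → true ∷ I ≤lex J
    least (false ∷ J) _ = true≤lexfalse
    least (true  ∷ J) (red′ , eq′) = ∷-≤lex true (min J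
      ( minimal⇒reduced (subword ω J) (minimal-tail (reduced⇒minimal (s ∷ subword ω J) red′))
      , ∙-cancelˡ (gen s) _ _ (trans eq′ (sym sβ≈α))))

  -- A reduced subword using the initial s would exhibit s as a descent.
  sort-¬descent : ∀ {s ω α I} → Minimal α → ¬ Descent s α →
                  IsSort ω ⟨ α ⟩ I → IsSort (s ∷ ω) ⟨ α ⟩ (false ∷ I)
  sort-¬descent {s} {ω} {α} {I} μ ¬d (red , min) = red , least
    where
    least : ∀ J → ReducedWordFor ⟨ α ⟩ (subword (s ∷ ω) J) → false ∷ I ≤lex J
    least (true  ∷ J) (red′ , eq) = ⊥-elim (¬d (subword ω J , eq , minimal-length (reduced⇒minimal (s ∷ subword ω J) red′) μ eq))
    least (false ∷ J) r           = ∷-≤lex false (min J r)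

  prefix-≤sort : ∀ ω α γ → Minimal (α ++ γ) → W[ ω ] ⟨ α ⟩ → W[ ω ] ⟨ α ++ γ ⟩ → ⟨ α ⟩ ≤[ ω ] ⟨ α ++ γ ⟩
  prefix-≤sort []      α γ μ wα wαγ = [] , [] , sort-[] wα , sort-[] wαγ , λ ()
  prefix-≤sort (s ∷ ω) α γ μ wα wαγ
    with ν ← minimal-++ˡ α γ μ
    with descent? (length α) s α ℕ.≤-refl ν | descent? (length (α ++ γ)) s (α ++ γ) ℕ.≤-refl μ
  -- A descent of the prefix `α` is a descent of `α ++ γ`, with the same `γ` left over.
  ... | yes d@(β , eq , len) | _ = lift (prefix-≤sort ω β γ
          (minimal-tail (minimal-resp (sym (proj₁ (proj₂ d′))) (≡.sym (proj₂ (proj₂ d′))) μ))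
          (W-descent ν d wα) (W-descent μ d′ wαγ))
    where
    d′ : Descent s (α ++ γ)
    d′ = β ++ γ , trans (⟨⟩-++ (s ∷ β) γ) (trans (∙-congʳ eq) (sym (⟨⟩-++ α γ))) ,
      ≡.trans (≡.cong suc (length-++ β)) (≡.trans (≡.cong (ℕ._+ length γ) len) (≡.sym (length-++ α)))
    lift : ⟨ β ⟩ ≤[ ω ] ⟨ β ++ γ ⟩ → ⟨ α ⟩ ≤[ s ∷ ω ] ⟨ α ++ γ ⟩
    lift (I , J , sI , sJ , I⊆J) = true ∷ I , true ∷ J , sort-descent ν d sI , sort-descent μ d′ sJ , s⊆s I⊆J
  ... | no ¬d | no ¬d′ = lift (prefix-≤sort ω α γ μ (W-¬descent ν ¬d wα) (W-¬descent μ ¬d′ wαγ))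
    where
    lift : ⟨ α ⟩ ≤[ ω ] ⟨ α ++ γ ⟩ → ⟨ α ⟩ ≤[ s ∷ ω ] ⟨ α ++ γ ⟩
    lift (I , J , sI , sJ , I⊆J) =
      false ∷ I , false ∷ J , sort-¬descent ν ¬d sI , sort-¬descent μ ¬d′ sJ , s⊆s I⊆J
  ... | no ¬d | yes (σ , eq , len) = split (remove-++ α γ (exchange μ σ (sym (gen-flip eq))
            (ℕ.≤-trans (ℕ.n≤1+n _) (ℕ.≤-reflexive len))))
    where
    split : gen s ∈ Φ α ⊎ ∃[ γ′ ] (length γ ≡ suc (length γ′) × gen s ∙ ⟨ α ++ γ ⟩ ≈ ⟨ α ++ γ′ ⟩) →
            ⟨ α ⟩ ≤[ s ∷ ω ] ⟨ α ++ γ ⟩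
    -- The exchanged letter cannot lie in `α`, since s would then be a descent of `α`.
    split (inj₁ s∈Φα) with β , _ , len-β , sα≈β ← remove α s∈Φα =
      ⊥-elim (¬d (β , sym (gen-flip sα≈β) , ≡.sym len-β))
    split (inj₂ (γ′ , len-γ , eq-γ)) = lift (prefix-≤sort ω α γ′
      (minimal-tail (minimal-resp (sym (proj₁ (proj₂ d′))) (≡.sym (proj₂ (proj₂ d′))) μ))
      (W-¬descent ν ¬d wα) (W-descent μ d′ wαγ))
      where
      d′ : Descent s (α ++ γ)
      d′ = α ++ γ′ , sym (gen-flip eq-γ) , ≡.trans (≡.cong suc (length-++ α))
        (≡.trans (≡.sym (ℕ.+-suc (length α) (length γ′)))
          (≡.trans (≡.cong (length α ℕ.+_) (≡.sym len-γ)) (≡.sym (length-++ α))))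
      lift : ⟨ α ⟩ ≤[ ω ] ⟨ α ++ γ′ ⟩ → ⟨ α ⟩ ≤[ s ∷ ω ] ⟨ α ++ γ ⟩
      lift (I , J , sI , sJ , I⊆J) =
        false ∷ I , true ∷ J , sort-¬descent ν ¬d sI , sort-descent μ d′ sJ , out⊆ I⊆J

  W-resp : ∀ ω {u v} → u ≈ v → W[ ω ] u → W[ ω ] v
  W-resp ω u≈v (I , eq) = I , trans eq u≈v

  sort-resp : ∀ ω {u v I} → u ≈ v → IsSort ω u I → IsSort ω v I
  sort-resp ω u≈v ((red , eq) , min) =
    (red , trans eq u≈v) , λ J (red′ , eq′) → min J (red′ , trans eq′ (sym u≈v))

  weak⇒sorting : ∀ ω {u w} → W[ ω ] u → W[ ω ] w → u ≤R w → u ≤[ ω ] w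
  weak⇒sorting ω wu ww (α , k , (red , α≈w) , _ , u≈) =
    let _ , _ , sI , sJ , I⊆J = prefix-≤sort ω (take k α) (drop k α)
          (≡.subst Minimal (≡.sym (take++drop≡id k α)) (reduced⇒minimal α red))
          (W-resp ω u≈ wu) (W-resp ω (sym αα≈w) ww)
    in _ , _ , sort-resp ω (sym u≈) sI , sort-resp ω αα≈w sJ , I⊆J
    where
    αα≈w = trans (reflexive (≡.cong ⟨_⟩ (take++drop≡id k α))) α≈w

  sorting⇒bruhat : ∀ ω {u w} → u ≤[ ω ] w → u ≤B w
  sorting⇒bruhat ω {u} (I , J , (rI , _) , (rJ , _) , I⊆J) with K , eq ← restrict ω I J I⊆J =
    subword ω J , K , rJ , ≡.subst (ReducedWordFor u) (≡.sym eq) rI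

theorem4p2 : ∀ {c ℓ a} (C : CoxeterSystem c ℓ a) →
    let open CoxeterSystem C
        open Orders C
    in (ω : List S) (u w : Carrier) → W[ ω ] u → W[ ω ] w →
       (u ≤R w → u ≤[ ω ] w) × (u ≤[ ω ] w → u ≤B w)
theorem4p2 C ω u w wu ww = weak⇒sorting ω wu ww , sorting⇒bruhat ω
  where open Coxeter C
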